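{- Let $X_n,Y_n$ $(n\ge0)$ be the sequences defined in the context and let $\psi$ be the real root of $x^3=x^2+x+1$. Then $$\lim_{n\to\infty}\frac{Y_n}{X_n}=\psi .$$
   Context: $\operatorname{mex}(S)$ is the smallest nonnegative integer not in $S$. Set $X_0=Y_0=M_0=P_0=0$ and, for $n>0$, $X_n=\operatorname{mex}\{X_i,Y_i:i<n\}$, $M_n=\operatorname{mex}\{M_i,P_i:i<n\}$, $Y_n=X_n+M_n$, $P_n=X_n+Y_n$. The number $\psi=1.839286755214\ldots$ is the Tribonacci constant. -}

module Defs where

open import Data.List.Base using (List; []; _∷_)
open import Data.List.Extrema.Nat using (max; xs≤max)
open import Data.List.Membership.DecPropositional using () renaming (_∈?_ to mem?)
open import Data.List.Membership.Propositional using (_∈_; _∉_)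
import Data.List.Relation.Unary.All as All
open import Data.List.Relation.Unary.Any using (here; there)
open import Data.Nat.Base as ℕ using (ℕ; zero; suc)
import Data.Nat.Properties as ℕ
import Data.Nat.Coprimality as Coprime
import Data.Integer.Base as ℤ
import Data.Integer.Properties as ℤ
open import Data.Product using (∃; ∃-syntax; _×_; _,_; proj₁; proj₂)
open import Data.Rational.Base as ℚ
  using (ℚ; 0ℚ; 1ℚ; ½; mkℚ; _+_; _*_; _-_; -_; ∣_∣; _<_; _≤_; *≤*; *<*)
open import Data.Rational.Properties
import Data.Rational.Unnormalised.Base as ℚᵘ
import Data.Rational.Unnormalised.Properties as ℚᵘ
open import Data.Sum.Base using (_⊎_; inj₁; inj₂)
open import Relation.Binary.PropositionalEquality
open import Relation.Nullary using (¬_; Dec; yes; no)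
open import Relation.Nullary.Decidable using (dec⇒maybe)
open import Tactic.RingSolver using (solve-∀)
open import Tactic.RingSolver.Core.AlmostCommutativeRing using (AlmostCommutativeRing; fromCommutativeRing)

------------------------------------------------------------------------
-- Minimum excludant

IsMex : List ℕ → ℕ → Set
IsMex S m = m ∉ S × (∀ k → k ℕ.< m → k ∈ S)

private
  search : ∀ S fuel k → (∀ j → j ℕ.< k → j ∈ S) →
           (∀ j → j ∈ S → j ℕ.< fuel ℕ.+ k) → ∃ (IsMex S)
  search S zero       k below bound = k , (λ k∈S → ℕ.<-irrefl refl (bound k k∈S)) , below
  search S (suc fuel) k below bound with mem? ℕ._≟_ k S
  ... | no  k∉S = k , k∉S , below
  ... | yes k∈S = search S fuel (suc k) below′
        (λ j j∈S → subst (j ℕ.<_) (sym (ℕ.+-suc fuel k)) (bound j j∈S))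
    where
    below′ : ∀ j → j ℕ.< suc k → j ∈ S
    below′ j j<1+k with ℕ.m≤n⇒m<n∨m≡n (ℕ.≤-pred j<1+k)
    ... | inj₁ j<k  = below j j<k
    ... | inj₂ refl = k∈S

  findMex : ∀ S → ∃ (IsMex S)
  findMex S = search S (suc (max 0 S)) 0 (λ _ ())
    (λ j j∈S → subst (j ℕ.<_) (sym (ℕ.+-identityʳ _))
                 (ℕ.s≤s (All.lookup (xs≤max 0 S) j∈S)))

mex : List ℕ → ℕ
mex S = proj₁ (findMex S)

mex-isMex : ∀ S → IsMex S (mex S)
mex-isMex S = proj₂ (findMex S)

------------------------------------------------------------------------
-- The four sequences.  XY n and MP n list the elements of the sets
-- {Xᵢ, Yᵢ : i < n} and {Mᵢ, Pᵢ : i < n}.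

X Y M P : ℕ → ℕ
XY MP : ℕ → List ℕ

XY zero    = []
XY (suc n) = X n ∷ Y n ∷ XY n

MP zero    = []
MP (suc n) = M n ∷ P n ∷ MP n

X zero    = 0
X (suc n) = mex (XY (suc n))

M zero    = 0
M (suc n) = mex (MP (suc n))

Y zero    = 0
Y (suc n) = X (suc n) ℕ.+ M (suc n)

P zero    = 0
P (suc n) = X (suc n) ℕ.+ Y (suc n)

X-nonZero : ∀ n → ℕ.NonZero (X (suc n))
X-nonZero n = ℕ.≢-nonZero λ X≡0 →
  proj₁ (mex-isMex (XY (suc n))) (subst (_∈ XY (suc n)) (sym X≡0) (0∈XY n))
  where
  0∈XY : ∀ n → 0 ∈ XY (suc n)
  0∈XY zero    = here refl
  0∈XY (suc n) = there (there (0∈XY n))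

------------------------------------------------------------------------
-- Real numbers, as Cauchy sequences of rationals

IsCauchy : (ℕ → ℚ) → Set
IsCauchy s = ∀ ε → 0ℚ < ε → ∃[ N ] ∀ m n → N ℕ.≤ m → N ℕ.≤ n → ∣ s m - s n ∣ < ε

record ℝ : Set where
  constructor mkℝ
  field
    seq    : ℕ → ℚ
    cauchy : IsCauchy seq

open ℝ public

infix  4 _≃ᵣ_ _<ᵣ_
infixl 6 _+ᵣ_ _-ᵣ_
infixl 7 _*ᵣ_

-- Distinct Cauchy sequences may represent the same real, so equality of
-- reals is _≃ᵣ_ and not _≡_.
_≃ᵣ_ : ℝ → ℝ → Set
x ≃ᵣ y = ∀ ε → 0ℚ < ε → ∃[ N ] ∀ n → N ℕ.≤ n → ∣ seq x n - seq y n ∣ < ε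

-- A pointwise inequality would not respect _≃ᵣ_: the gap has to stay
-- bounded away from zero.
_<ᵣ_ : ℝ → ℝ → Set
x <ᵣ y = ∃[ δ ] 0ℚ < δ × ∃[ N ] ∀ n → N ℕ.≤ n → seq x n + δ < seq y n

private
  open ≤-Reasoning

  ℚring : AlmostCommutativeRing _ _
  ℚring = fromCommutativeRing +-*-commutativeRing (λ q → dec⇒maybe (0ℚ ≟ q))

  neg-sub : ∀ p q → - (p - q) ≡ q - p
  neg-sub = solve-∀ ℚring

  sub-add : ∀ p q → p ≡ (p - q) + q
  sub-add = solve-∀ ℚring

  add-sub : ∀ p q → p + q - q ≡ p
  add-sub = solve-∀ ℚring

  add-sub′ : ∀ p q → p + q - p ≡ q
  add-sub′ = solve-∀ ℚring

  neg-sub-neg : ∀ p q → q - p ≡ - p - - q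
  neg-sub-neg = solve-∀ ℚring

  sub-interchange : ∀ a b c d → (a + b) - (c + d) ≡ (a - c) + (b - d)
  sub-interchange = solve-∀ ℚring

  sub-products : ∀ a b c d → a * b - c * d ≡ a * (b - d) + d * (a - c)
  sub-products = solve-∀ ℚring

  *-pos : ∀ {p q} → 0ℚ < p → 0ℚ < q → 0ℚ < p * q
  *-pos {p} {q} 0<p 0<q =
    positive⁻¹ (p * q) {{pos*pos⇒pos p {{ℚ.positive 0<p}} q {{ℚ.positive 0<q}}}}

  *-monoˡ : ∀ {r p q} → 0ℚ ≤ r → p ≤ q → r * p ≤ r * q
  *-monoˡ {r} 0≤r = *-monoˡ-≤-nonNeg r {{ℚ.nonNegative 0≤r}}

  *-monoʳ : ∀ {r p q} → 0ℚ ≤ r → p ≤ q → p * r ≤ q * r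
  *-monoʳ {r} 0≤r = *-monoʳ-≤-nonNeg r {{ℚ.nonNegative 0≤r}}

  *-nonNeg : ∀ {p q} → 0ℚ ≤ p → 0ℚ ≤ q → 0ℚ ≤ p * q
  *-nonNeg {p} {q} 0≤p 0≤q = subst (_≤ p * q) (*-zeroʳ p) (*-monoˡ 0≤p 0≤q)

  0<½ : 0ℚ < ½
  0<½ = positive⁻¹ ½

  halves : ∀ ε → ½ * ε + ½ * ε ≡ ε
  halves = solve-∀ ℚring

  divide : ∀ B ε → 0ℚ < B → 0ℚ < ε → ∃[ δ ] 0ℚ < δ × B * δ ≡ ε
  divide B ε 0<B 0<ε = ℚ.1/ B * ε , *-pos (positive⁻¹ (ℚ.1/ B) {{1/pos⇒pos B}}) 0<ε , eq
    where
    instance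
      B-pos = ℚ.positive 0<B
      B-nonZero = pos⇒nonZero B
    eq : B * (ℚ.1/ B * ε) ≡ ε
    eq = trans (sym (*-assoc B (ℚ.1/ B) ε))
           (trans (cong (_* ε) (*-inverseʳ B)) (*-identityˡ ε))

  ∣p∣-∣q∣≤∣p-q∣ : ∀ p q → ∣ p ∣ - ∣ q ∣ ≤ ∣ p - q ∣
  ∣p∣-∣q∣≤∣p-q∣ p q = begin
    ∣ p ∣ - ∣ q ∣                ≡⟨ cong (λ z → ∣ z ∣ - ∣ q ∣) (sub-add p q) ⟩
    ∣ (p - q) + q ∣ - ∣ q ∣      ≤⟨ +-monoˡ-≤ (- ∣ q ∣) (∣p+q∣≤∣p∣+∣q∣ (p - q) q) ⟩
    ∣ p - q ∣ + ∣ q ∣ - ∣ q ∣    ≡⟨ add-sub ∣ p - q ∣ ∣ q ∣ ⟩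
    ∣ p - q ∣                    ∎

  ∣∣-bound : ∀ {p ε} → p < ε → - p < ε → ∣ p ∣ < ε
  ∣∣-bound {p} {ε} p<ε -p<ε with ∣p∣≡p∨∣p∣≡-p p
  ... | inj₁ eq = subst (_< ε) (sym eq) p<ε
  ... | inj₂ eq = subst (_< ε) (sym eq) -p<ε

  const-cauchy : ∀ q → IsCauchy (λ _ → q)
  const-cauchy q ε 0<ε = 0 , λ _ _ _ _ →
    subst (λ z → ∣ z ∣ < ε) (sym (+-inverseʳ q)) 0<ε

  +-cauchy : ∀ {s t} → IsCauchy s → IsCauchy t → IsCauchy (λ n → s n + t n)
  +-cauchy {s} {t} cs ct ε 0<ε with cs (½ * ε) (*-pos 0<½ 0<ε) | ct (½ * ε) (*-pos 0<½ 0<ε)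
  ... | N , hs | N′ , ht = N ℕ.⊔ N′ , λ m n m≥ n≥ → begin-strict
    ∣ (s m + t m) - (s n + t n) ∣
      ≡⟨ cong ∣_∣ (sub-interchange (s m) (t m) (s n) (t n)) ⟩
    ∣ (s m - s n) + (t m - t n) ∣      ≤⟨ ∣p+q∣≤∣p∣+∣q∣ (s m - s n) (t m - t n) ⟩
    ∣ s m - s n ∣ + ∣ t m - t n ∣
      <⟨ +-mono-< (hs m n (ℕ.m⊔n≤o⇒m≤o N N′ m≥) (ℕ.m⊔n≤o⇒m≤o N N′ n≥))
                  (ht m n (ℕ.m⊔n≤o⇒n≤o N N′ m≥) (ℕ.m⊔n≤o⇒n≤o N N′ n≥)) ⟩
    ½ * ε + ½ * ε                      ≡⟨ halves ε ⟩
    ε                                  ∎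

  neg-cauchy : ∀ {s} → IsCauchy s → IsCauchy (λ n → - s n)
  neg-cauchy {s} cs ε 0<ε with cs ε 0<ε
  ... | N , hs = N , λ m n m≥ n≥ →
    subst (_< ε) (cong ∣_∣ (neg-sub-neg (s m) (s n))) (hs n m n≥ m≥)

  abs-cauchy : ∀ {s} → IsCauchy s → IsCauchy (λ n → ∣ s n ∣)
  abs-cauchy {s} cs ε 0<ε with cs ε 0<ε
  ... | N , hs = N , λ m n m≥ n≥ → ∣∣-bound
    (≤-<-trans (∣p∣-∣q∣≤∣p-q∣ (s m) (s n)) (hs m n m≥ n≥))
    (subst (_< ε) (sym (neg-sub ∣ s m ∣ ∣ s n ∣))
      (≤-<-trans (∣p∣-∣q∣≤∣p-q∣ (s n) (s m)) (hs n m n≥ m≥)))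

  bounded : ∀ {s} → IsCauchy s → ∃[ B ] 0ℚ < B × ∃[ N ] ∀ n → N ℕ.≤ n → ∣ s n ∣ < B
  bounded {s} cs with cs 1ℚ (positive⁻¹ 1ℚ)
  ... | N , hs = ∣ s N ∣ + 1ℚ , +-mono-≤-< (0≤∣p∣ (s N)) (positive⁻¹ 1ℚ) , N , λ n n≥ → begin-strict
    ∣ s n ∣                      ≡⟨ cong ∣_∣ (trans (sub-add (s n) (s N)) (+-comm (s n - s N) (s N))) ⟩
    ∣ s N + (s n - s N) ∣        ≤⟨ ∣p+q∣≤∣p∣+∣q∣ (s N) (s n - s N) ⟩
    ∣ s N ∣ + ∣ s n - s N ∣      <⟨ +-monoʳ-< ∣ s N ∣ (hs n N n≥ ℕ.≤-refl) ⟩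
    ∣ s N ∣ + 1ℚ                 ∎

  *-small : ∀ {B δ ε p q} → 0ℚ < B → B * δ ≡ ε → ∣ p ∣ < B → ∣ q ∣ < δ → ∣ p * q ∣ < ε
  *-small {B} {δ} {ε} {p} {q} 0<B eq ∣p∣<B ∣q∣<δ = begin-strict
    ∣ p * q ∣      ≡⟨ ∣p*q∣≡∣p∣*∣q∣ p q ⟩
    ∣ p ∣ * ∣ q ∣  ≤⟨ *-monoʳ (0≤∣p∣ q) (<⇒≤ ∣p∣<B) ⟩
    B * ∣ q ∣      <⟨ *-monoʳ-<-pos B {{ℚ.positive 0<B}} ∣q∣<δ ⟩
    B * δ          ≡⟨ eq ⟩
    ε              ∎

  *-estimate : ∀ {ε} a b c d → ∣ a * (b - d) ∣ < ½ * ε → ∣ d * (a - c) ∣ < ½ * ε →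
               ∣ a * b - c * d ∣ < ε
  *-estimate {ε} a b c d h h′ = begin-strict
    ∣ a * b - c * d ∣                    ≡⟨ cong ∣_∣ (sub-products a b c d) ⟩
    ∣ a * (b - d) + d * (a - c) ∣        ≤⟨ ∣p+q∣≤∣p∣+∣q∣ (a * (b - d)) (d * (a - c)) ⟩
    ∣ a * (b - d) ∣ + ∣ d * (a - c) ∣    <⟨ +-mono-< h h′ ⟩
    ½ * ε + ½ * ε                        ≡⟨ halves ε ⟩
    ε                                    ∎

  *-cauchy : ∀ {s t} → IsCauchy s → IsCauchy t → IsCauchy (λ n → s n * t n)
  *-cauchy {s} {t} cs ct ε 0<ε =
    let B , 0<B , K , hB = bounded cs
        C , 0<C , L , hC = bounded ct
        δ , 0<δ , Bδ≡ = divide B (½ * ε) 0<B (*-pos 0<½ 0<ε)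
        η , 0<η , Cη≡ = divide C (½ * ε) 0<C (*-pos 0<½ 0<ε)
        N , ht = ct δ 0<δ
        N′ , hs = cs η 0<η
    in (K ℕ.⊔ L) ℕ.⊔ (N ℕ.⊔ N′) , λ m n m≥ n≥ →
    let m≥₁ = ℕ.m⊔n≤o⇒m≤o (K ℕ.⊔ L) (N ℕ.⊔ N′) m≥
        m≥₂ = ℕ.m⊔n≤o⇒n≤o (K ℕ.⊔ L) (N ℕ.⊔ N′) m≥
        n≥₁ = ℕ.m⊔n≤o⇒m≤o (K ℕ.⊔ L) (N ℕ.⊔ N′) n≥
        n≥₂ = ℕ.m⊔n≤o⇒n≤o (K ℕ.⊔ L) (N ℕ.⊔ N′) n≥
    in *-estimate {ε} (s m) (t m) (s n) (t n)
         (*-small {p = s m} 0<B Bδ≡ (hB m (ℕ.m⊔n≤o⇒m≤o K L m≥₁))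
            (ht m n (ℕ.m⊔n≤o⇒m≤o N N′ m≥₂) (ℕ.m⊔n≤o⇒m≤o N N′ n≥₂)))
         (*-small {p = t n} 0<C Cη≡ (hC n (ℕ.m⊔n≤o⇒n≤o K L n≥₁))
            (hs m n (ℕ.m⊔n≤o⇒n≤o N N′ m≥₂) (ℕ.m⊔n≤o⇒n≤o N N′ n≥₂)))

fromℚ : ℚ → ℝ
fromℚ q = mkℝ (λ _ → q) (const-cauchy q)

0ᵣ 1ᵣ : ℝ
0ᵣ = fromℚ 0ℚ
1ᵣ = fromℚ 1ℚ

_+ᵣ_ _*ᵣ_ _-ᵣ_ : ℝ → ℝ → ℝ
∣_∣ᵣ : ℝ → ℝ
x +ᵣ y = mkℝ (λ n → seq x n + seq y n) (+-cauchy {seq x} {seq y} (cauchy x) (cauchy y))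
x *ᵣ y = mkℝ (λ n → seq x n * seq y n) (*-cauchy {seq x} {seq y} (cauchy x) (cauchy y))
x -ᵣ y = mkℝ (λ n → seq x n - seq y n) (+-cauchy {seq x} (cauchy x) (neg-cauchy {seq y} (cauchy y)))
∣ x ∣ᵣ = mkℝ (λ n → ∣ seq x n ∣) (abs-cauchy {seq x} (cauchy x))

Limit : (ℕ → ℝ) → ℝ → Set
Limit a l = ∀ ε → 0ᵣ <ᵣ ε → ∃[ N ] ∀ n → N ℕ.≤ n → ∣ a n -ᵣ l ∣ᵣ <ᵣ ε

------------------------------------------------------------------------
-- The Tribonacci constant

IsTribonacciRoot : ℝ → Set
IsTribonacciRoot x = x *ᵣ x *ᵣ x ≃ᵣ x *ᵣ x +ᵣ x +ᵣ 1ᵣ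

-- IsTribonacciRoot is inhabited.  With x = 1 + t the equation becomes
-- f t = 0 for f below, which increases on t ≥ 0; bisect [0, 1].
private
  2ℚ : ℚ
  2ℚ = 1ℚ + 1ℚ

  f : ℚ → ℚ
  f t = t * t * (t + 2ℚ) - 2ℚ

  f-mono : ∀ {s t} → 0ℚ ≤ s → s ≤ t → f s ≤ f t
  f-mono {s} {t} 0≤s s≤t = +-monoˡ-≤ (- 2ℚ) (begin
    s * s * (s + 2ℚ) ≤⟨ *-monoʳ (+-mono-≤ 0≤s (nonNegative⁻¹ 2ℚ)) (≤-trans (*-monoˡ 0≤s s≤t) (*-monoʳ 0≤t s≤t)) ⟩
    t * t * (s + 2ℚ) ≤⟨ *-monoˡ (*-nonNeg 0≤t 0≤t) (+-monoˡ-≤ 2ℚ s≤t) ⟩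
    t * t * (t + 2ℚ) ∎)
    where 0≤t = ≤-trans 0≤s s≤t

  f-reflects : ∀ {s t} → 0ℚ ≤ t → f s ≤ 0ℚ → ¬ f t ≤ 0ℚ → s < t
  f-reflects 0≤t fs ft = ≰⇒> λ t≤s → ft (≤-trans (f-mono 0≤t t≤s) fs)

  gap : ℕ → ℚ
  gap zero    = 1ℚ
  gap (suc n) = ½ * gap n

  gap-pos : ∀ n → 0ℚ < gap n
  gap-pos zero    = positive⁻¹ 1ℚ
  gap-pos (suc n) = *-pos 0<½ (gap-pos n)

  gap≤1 : ∀ n → gap n ≤ 1ℚ
  gap≤1 zero    = ≤-refl
  gap≤1 (suc n) = ≤-trans (*-monoˡ (<⇒≤ 0<½) (gap≤1 n)) (≤ᵇ⇒≤ _)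

  fromℕ : ℕ → ℚ
  fromℕ n = mkℚ (ℤ.+ n) 0 (Coprime.sym (Coprime.1-coprimeTo n))

  fromℕ-suc : ∀ n → fromℕ (suc n) ≡ fromℕ n + 1ℚ
  fromℕ-suc n = toℚᵘ-injective (ℚᵘ.≃-trans (ℚᵘ.*≡* eq) (ℚᵘ.≃-sym (toℚᵘ-homo-+ (fromℕ n) 1ℚ)))
    where
    eq : ℤ.+ suc n ℤ.* ℤ.+ 1 ≡ (ℤ.+ n ℤ.* ℤ.+ 1 ℤ.+ ℤ.+ 1 ℤ.* ℤ.+ 1) ℤ.* ℤ.+ 1
    eq = cong (ℤ._* ℤ.+ 1) (trans (cong ℤ.+_ (ℕ.+-comm 1 n)) (cong (ℤ._+ ℤ.+ 1) (sym (ℤ.*-identityʳ (ℤ.+ n)))))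

  split-half : ∀ p q → (p + 1ℚ) * (½ * q) ≡ ½ * (p * q) + ½ * q
  split-half = solve-∀ ℚring

  n*gap<1 : ∀ n → fromℕ n * gap n < 1ℚ
  n*gap<1 zero    = subst (_< 1ℚ) (sym (*-zeroˡ 1ℚ)) (positive⁻¹ 1ℚ)
  n*gap<1 (suc n) = begin-strict
    fromℕ (suc n) * (½ * gap n)                ≡⟨ cong (_* (½ * gap n)) (fromℕ-suc n) ⟩
    (fromℕ n + 1ℚ) * (½ * gap n)
      ≡⟨ split-half (fromℕ n) (gap n) ⟩
    ½ * (fromℕ n * gap n) + ½ * gap n
      <⟨ +-mono-<-≤ (*-monoʳ-<-pos ½ (n*gap<1 n)) (*-monoˡ (<⇒≤ 0<½) (gap≤1 n)) ⟩
    ½ * 1ℚ + ½ * 1ℚ                            ≡⟨ halves 1ℚ ⟩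
    1ℚ                                         ∎

  1≤den*ε : ∀ ε → 0ℚ < ε → ∃[ n ] 1ℚ ≤ fromℕ (suc n) * ε
  1≤den*ε ε@(mkℚ (ℤ.+ zero) d c) 0<ε with ℚ.positive 0<ε
  ... | ()
  1≤den*ε ε@(mkℚ ℤ.-[1+ a ] d c) 0<ε with ℚ.positive 0<ε
  ... | ()
  1≤den*ε ε@(mkℚ ℤ.+[1+ a ] d c) 0<ε = d ,
    toℚᵘ-cancel-≤ (ℚᵘ.≤-trans (ℚᵘ.*≤* le) (ℚᵘ.≤-reflexive (ℚᵘ.≃-sym (toℚᵘ-homo-* (fromℕ (suc d)) ε))))
    where
    le : ℤ.+ 1 ℤ.* ℤ.+ (1 ℕ.* suc d) ℤ.≤ (ℤ.+ suc d ℤ.* ℤ.+ suc a) ℤ.* ℤ.+ 1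
    le = subst₂ ℤ._≤_
      (cong ℤ.+_ (sym (trans (ℕ.*-identityˡ _) (ℕ.*-identityˡ (suc d)))))
      (sym (ℤ.*-identityʳ _))
      (ℤ.+≤+ (ℕ.m≤m*n (suc d) (suc a)))

  gap-antimono : ∀ {m n} → m ℕ.≤ n → gap n ≤ gap m
  gap-antimono m≤n = go (ℕ.≤⇒≤′ m≤n)
    where
    go : ∀ {m n} → m ℕ.≤′ n → gap n ≤ gap m
    go (ℕ.≤′-reflexive refl) = ≤-refl
    go {m} {suc n} (ℕ.≤′-step m≤n) = ≤-trans
      (begin
        ½ * gap n   ≤⟨ *-monoʳ {gap n} {½} {1ℚ} (<⇒≤ (gap-pos n)) (≤ᵇ⇒≤ _) ⟩
        1ℚ * gap n  ≡⟨ *-identityˡ (gap n) ⟩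
        gap n       ∎)
      (go m≤n)

  gap-small : ∀ ε → 0ℚ < ε → ∃[ N ] ∀ n → N ℕ.≤ n → gap n < ε
  gap-small ε 0<ε with 1≤den*ε ε 0<ε
  ... | d , 1≤ = suc d , λ n n≥ → ≤-<-trans (gap-antimono n≥)
    (*-cancelˡ-<-nonNeg (fromℕ (suc d)) (<-≤-trans (n*gap<1 (suc d)) 1≤))

  Bracket : ℕ → ℚ → Set
  Bracket n t = 0ℚ ≤ t × f t ≤ 0ℚ × ¬ f (t + gap n) ≤ 0ℚ

  refine : ∀ n → ∃ (Bracket n) → ∃ (Bracket (suc n))
  refine n (t , 0≤t , ft , ft′) = choose (f (t + gap (suc n)) ≤? 0ℚ)
    where
    midpoint-step : t + gap (suc n) + gap (suc n) ≡ t + gap n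
    midpoint-step = trans (+-assoc t (gap (suc n)) (gap (suc n))) (cong (λ z → t + z) (halves (gap n)))

    choose : Dec (f (t + gap (suc n)) ≤ 0ℚ) → ∃ (Bracket (suc n))
    choose (no  h) = t , 0≤t , ft , h
    choose (yes h) = t + gap (suc n) , +-mono-≤ 0≤t (<⇒≤ (gap-pos (suc n))) , h ,
      λ h′ → ft′ (subst (λ z → f z ≤ 0ℚ) midpoint-step h′)

  bisect : ∀ n → ∃ (Bracket n)
  bisect zero    = 0ℚ , ≤-refl , ≤ᵇ⇒≤ _ , λ h → ≤⇒≤ᵇ h
  bisect (suc n) = refine n (bisect n)

  t : ℕ → ℚ
  t n = proj₁ (bisect n)

  0≤t : ∀ n → 0ℚ ≤ t n
  0≤t n = proj₁ (proj₂ (bisect n))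

  f-lo : ∀ n → f (t n) ≤ 0ℚ
  f-lo n = proj₁ (proj₂ (proj₂ (bisect n)))

  f-hi : ∀ n → ¬ f (t n + gap n) ≤ 0ℚ
  f-hi n = proj₂ (proj₂ (proj₂ (bisect n)))

  t-near : ∀ m n → t m - t n < gap n
  t-near m n = subst (t m - t n <_) (add-sub′ (t n) (gap n))
    (+-monoˡ-< (- t n) (f-reflects {t m} {t n + gap n} (+-mono-≤ (0≤t n) (<⇒≤ (gap-pos n))) (f-lo m) (f-hi n)))

  t≤1 : ∀ n → t n ≤ 1ℚ
  t≤1 n = <⇒≤ (f-reflects {t n} {1ℚ} (nonNegative⁻¹ 1ℚ) (f-lo n) (λ h → ≤⇒≤ᵇ h))

  shift-sub : ∀ p q → p - q ≡ (1ℚ + p) - (1ℚ + q)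
  shift-sub = solve-∀ ℚring

  root-cauchy : IsCauchy (λ n → 1ℚ + t n)
  root-cauchy ε 0<ε =
    let N , h = gap-small ε 0<ε in N , λ m n m≥ n≥ → subst (λ z → ∣ z ∣ < ε)
      (shift-sub (t m) (t n))
      (∣∣-bound (<-trans (t-near m n) (h n n≥))
        (subst (_< ε) (sym (neg-sub (t m) (t n))) (<-trans (t-near n m) (h m m≥))))

  *≤1 : ∀ {p q} → 0ℚ ≤ p → p ≤ 1ℚ → q ≤ 1ℚ → p * q ≤ 1ℚ
  *≤1 {p} 0≤p p≤1 q≤1 = ≤-trans (*-monoˡ 0≤p q≤1) (subst (_≤ 1ℚ) (sym (*-identityʳ p)) p≤1)

  3ℚ 4ℚ 13ℚ : ℚ
  3ℚ = 2ℚ + 1ℚ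
  4ℚ = 2ℚ + 2ℚ
  13ℚ = 3ℚ + 3ℚ + 1ℚ + 4ℚ + 2ℚ

  slope : ℚ → ℚ → ℚ
  slope a e = 3ℚ * (a * a) + 3ℚ * (a * e) + e * e + 4ℚ * a + 2ℚ * e

  f-difference : ∀ a e → f (a + e) - f a ≡ slope a e * e
  f-difference = expanded
    where
    expanded : ∀ a e →
      ((a + e) * (a + e) * ((a + e) + (1ℚ + 1ℚ)) - (1ℚ + 1ℚ)) - (a * a * (a + (1ℚ + 1ℚ)) - (1ℚ + 1ℚ)) ≡
      ((1ℚ + 1ℚ + 1ℚ) * (a * a) + (1ℚ + 1ℚ + 1ℚ) * (a * e) + e * e
        + (1ℚ + 1ℚ + (1ℚ + 1ℚ)) * a + (1ℚ + 1ℚ) * e) * e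
    expanded = solve-∀ ℚring

  f-shift : ∀ t → f t ≡ (1ℚ + t) * (1ℚ + t) * (1ℚ + t) - ((1ℚ + t) * (1ℚ + t) + (1ℚ + t) + 1ℚ)
  f-shift = expanded
    where
    expanded : ∀ t → t * t * (t + (1ℚ + 1ℚ)) - (1ℚ + 1ℚ) ≡
      (1ℚ + t) * (1ℚ + t) * (1ℚ + t) - ((1ℚ + t) * (1ℚ + t) + (1ℚ + t) + 1ℚ)
    expanded = solve-∀ ℚring

  f-slope : ∀ n → - f (t n) < 13ℚ * gap n
  f-slope n = begin-strict
    - f a                         ≡⟨ sym (+-identityˡ (- f a)) ⟩
    0ℚ - f a                      <⟨ +-monoˡ-< (- f a) (≰⇒> (f-hi n)) ⟩
    f (a + e) - f a
      ≡⟨ f-difference a e ⟩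
    slope a e * e
      ≤⟨ *-monoʳ 0≤e (+-mono-≤ (+-mono-≤ (+-mono-≤ (+-mono-≤
           (*-monoˡ {3ℚ} (nonNegative⁻¹ 3ℚ) (*≤1 0≤a a≤1 a≤1))
           (*-monoˡ {3ℚ} (nonNegative⁻¹ 3ℚ) (*≤1 0≤a a≤1 e≤1)))
           (*≤1 0≤e e≤1 e≤1))
           (*-monoˡ {4ℚ} (nonNegative⁻¹ 4ℚ) a≤1))
           (*-monoˡ {2ℚ} (nonNegative⁻¹ 2ℚ) e≤1)) ⟩
    13ℚ * e                       ∎
    where
    a = t n
    e = gap n
    0≤a = 0≤t n
    a≤1 = t≤1 n
    0≤e = <⇒≤ (gap-pos n)
    e≤1 = gap≤1 n

tribonacciRoot-exists : ∃ IsTribonacciRoot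
tribonacciRoot-exists = mkℝ (λ n → 1ℚ + t n) root-cauchy , isRoot
  where
  isRoot : IsTribonacciRoot (mkℝ (λ n → 1ℚ + t n) root-cauchy)
  isRoot ε 0<ε =
    let δ , 0<δ , 13δ≡ε = divide 13ℚ ε (positive⁻¹ 13ℚ) 0<ε
        N , h = gap-small δ 0<δ
    in N , λ n n≥ → subst (λ z → ∣ z ∣ < ε) (f-shift (t n))
      (∣∣-bound (≤-<-trans (f-lo n) 0<ε)
        (<-trans (f-slope n) (subst (13ℚ * gap n <_) 13δ≡ε (*-monoʳ-<-pos 13ℚ (h n n≥)))))

{-# OPTIONS --safe #-}
module Submission where

-- Let a(n) be the number of j > 0 with Y j < X n, and b(n) the number of j > 0
-- with P j < M n.  The positive values of X and Y partition the positive
-- integers, and Y skips at least one integer at each step, so X n = n + a(n)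
-- with Y (a n) ≤ X n < Y (a n + 1); in the same way M n = n + b(n) with
-- P (b n) ≤ M n < P (b n + 1).
--
-- If X n ~ αn and M n ~ γn, then Y n ~ βn and P n ~ δn with β = α + γ and
-- δ = α + β, and complementarity forces 1/α + 1/β = 1 = 1/γ + 1/δ.  With
-- r = β/α this says α = (r + 1)/r, γ = (r² - 1)/r and r³ = r² + r + 1.  To
-- stay within the rationals, r is taken to be a rational number slightly
-- above ψ, so that f = r³ - (r² + r + 1) is nonnegative and small.  The
-- errors are
--   U n = r (X n - αn)   and   V n = r (M n - γn).
-- The inequalities above turn into (with a = a n, b = b n)
--   r U n  ≤ - (U a + V a),         r U n  ≥ - (U (a+1) + V (a+1)) - r²,
--   r² V n ≤ - (2 U b + V b),       r² V n ≥ - (2 U (b+1) + V (b+1)) - O(1) - O(fn).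
-- For f = 0 the matrix of the absolute values of the coefficients has the
-- eigenvalue 1, with eigenvector (1, r - 1).  Hence for every ε > 0 the bounds
--   |U n| ≤ εn + C   and   |V n| ≤ (r - 1)(εn + C)
-- propagate by strong induction: C takes care of an initial segment, and
-- beyond it the remainders are absorbed because n - b(n) ≥ n/2 and because
-- n - a(n) tends to infinity, provided that f ≤ ε/4.  Finally
-- r (Y n - r X n) = V n - (r - 1) U n, so |Y n / X n - r| ≤ 3ε for large n.

open import Defs
open import Data.List.Base using (List; []; _∷_)
open import Data.List.Membership.Propositional using (_∈_; _∉_)
open import Data.List.Relation.Unary.Any using (here; there)
open import Data.Nat.Base as ℕ using (ℕ; zero; suc)
open import Data.Nat.Induction using (<-rec)
import Data.Nat.Properties as ℕ
open import Data.Integer.Base as ℤ using (+_)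
import Data.Integer.Properties as ℤ
open import Data.Product using (∃; ∃-syntax; _×_; _,_; proj₁; proj₂)
open import Data.Rational.Base as ℚ
  using (ℚ; 0ℚ; 1ℚ; ½; mkℚ; _/_; _+_; _*_; _-_; -_; ∣_∣; _<_; _≤_)
open import Data.Rational.Properties
import Data.Rational.Unnormalised.Base as ℚᵘ
import Data.Rational.Unnormalised.Properties as ℚᵘ
open import Data.Sum.Base using (_⊎_; inj₁; inj₂)
open import Relation.Binary.Definitions using (tri<; tri≈; tri>)
open import Relation.Binary.PropositionalEquality
open import Relation.Nullary using (yes; no; contradiction)
open import Relation.Nullary.Decidable using (dec⇒maybe; toWitness)
open import Tactic.RingSolver using (solve-∀)
open import Tactic.RingSolver.Core.AlmostCommutativeRing using (AlmostCommutativeRing; fromCommutativeRing)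

------------------------------------------------------------------------
-- Complementary sequences generated by mex

isMex-unique : ∀ {S m n} → IsMex S m → IsMex S n → m ≡ n
isMex-unique {_} {m} {n} (m∉S , m-least) (n∉S , n-least) with ℕ.<-cmp m n
... | tri< m<n _ _ = contradiction (n-least m m<n) m∉S
... | tri≈ _ m≡n _ = m≡n
... | tri> _ _ n<m = contradiction (m-least n n<m) n∉S

module StrictlyIncreasing (s : ℕ → ℕ) (s-suc : ∀ n → s n ℕ.< s (suc n)) where

  mono′ : ∀ {m n} → m ℕ.≤′ n → s m ℕ.≤ s n
  mono′ (ℕ.≤′-reflexive refl)  = ℕ.≤-refl
  mono′ (ℕ.≤′-step {n} m≤n)    = ℕ.≤-trans (mono′ m≤n) (ℕ.<⇒≤ (s-suc n))

  mono : ∀ {m n} → m ℕ.≤ n → s m ℕ.≤ s n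
  mono m≤n = mono′ (ℕ.≤⇒≤′ m≤n)

  reflect : ∀ {m n} → s m ℕ.< s n → m ℕ.< n
  reflect sm<sn = ℕ.≰⇒> λ n≤m → ℕ.<⇒≱ sm<sn (mono n≤m)

  n≤s : ∀ n → n ℕ.≤ s n
  n≤s zero    = ℕ.z≤n
  n≤s (suc n) = ℕ.≤-<-trans (n≤s n) (s-suc n)

-- Two sequences x, y, where x 0 = 0 and each later term of x is the least
-- value not used before it; L n lists the values x i, y i with i < n.
module Greedy (x y : ℕ → ℕ) (L : ℕ → List ℕ)
  (L-zero : L 0 ≡ []) (L-suc : ∀ n → L (suc n) ≡ x n ∷ y n ∷ L n)
  (x-zero : x 0 ≡ 0) (x-mex : ∀ n → IsMex (L (suc n)) (x (suc n)))
  where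

  ∈-L⁻ : ∀ n {k} → k ∈ L n → ∃[ i ] i ℕ.< n × (k ≡ x i ⊎ k ≡ y i)
  ∈-L⁻ zero    k∈ with () ← subst (_ ∈_) L-zero k∈
  ∈-L⁻ (suc n) k∈ with subst (_ ∈_) (L-suc n) k∈
  ... | here eq          = n , ℕ.≤-refl , inj₁ eq
  ... | there (here eq)  = n , ℕ.≤-refl , inj₂ eq
  ... | there (there k∈′) with i , i<n , eq ← ∈-L⁻ n k∈′ = i , ℕ.m≤n⇒m≤1+n i<n , eq

  L-⊆ : ∀ n {k} → k ∈ L n → k ∈ L (suc n)
  L-⊆ n k∈ = subst (_ ∈_) (sym (L-suc n)) (there (there k∈))

  x∈L : ∀ n → x n ∈ L (suc n)
  x∈L n = subst (_ ∈_) (sym (L-suc n)) (here refl)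

  y∈L : ∀ {i n} → i ℕ.≤′ n → y i ∈ L (suc n)
  y∈L {i} (ℕ.≤′-reflexive refl) = subst (_ ∈_) (sym (L-suc i)) (there (here refl))
  y∈L     (ℕ.≤′-step {n} i≤n)   = L-⊆ (suc n) (y∈L i≤n)

  below-x : ∀ n {k} → k ℕ.< x n → k ∈ L n
  below-x zero    k<x with () ← subst (_ ℕ.<_) x-zero k<x
  below-x (suc n) k<x = proj₂ (x-mex n) _ k<x

  x-suc : ∀ n → x n ℕ.< x (suc n)
  x-suc n = ℕ.≰⇒> λ x′≤x → proj₁ (x-mex n) (≤x⇒∈ x′≤x)
    where
    ≤x⇒∈ : ∀ {k} → k ℕ.≤ x n → k ∈ L (suc n)
    ≤x⇒∈ k≤x with ℕ.m≤n⇒m<n∨m≡n k≤x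
    ... | inj₁ k<x  = L-⊆ n (below-x n k<x)
    ... | inj₂ refl = x∈L n

  open StrictlyIncreasing x x-suc public using () renaming (mono to x-mono; n≤s to n≤x)

  -- If consecutive values of y are at least 2 apart, then x skips at most one
  -- value at a time, namely the next value of y.
  module Counting (y-zero : y 0 ≡ 0) (y-gap : ∀ n → 2 ℕ.+ y n ℕ.≤ y (suc n))
                  (x<y : ∀ n → x (suc n) ℕ.< y (suc n)) where

    open StrictlyIncreasing y (λ n → ℕ.<-trans (ℕ.n<1+n _) (y-gap n))
      using () renaming (reflect to y-reflect)

    -- The last index a with y a ≤ x n is also the difference x n - n.  Since
    -- the positive values of x and y are distinct, a is the number of j > 0
    -- with y j < x n, and y a = x n only for n = a = 0.
    Splits : ℕ → ℕ → Set
    Splits n a = x n ≡ n ℕ.+ a × y a ℕ.≤ x n × x n ℕ.< y (suc a)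

    ≤x⇒∈L : ∀ n {k} → k ℕ.≤ x n → k ∈ L (suc n)
    ≤x⇒∈L n k≤x = proj₂ (x-mex n) _ (ℕ.≤-<-trans k≤x (x-suc n))

    -- A number above x n and strictly between two consecutive values of y is
    -- unused.
    fresh : ∀ n a k → x n ℕ.< k → y a ℕ.< k → k ℕ.< y (suc a) → k ∉ L (suc n)
    fresh n a k xn<k ya<k k<y k∈ with ∈-L⁻ (suc n) k∈
    ... | i , i≤n , inj₁ refl = ℕ.<⇒≱ xn<k (x-mono (ℕ.≤-pred i≤n))
    ... | i , i≤n , inj₂ refl = ℕ.<⇒≱ (y-reflect {a} {i} ya<k) (ℕ.≤-pred (y-reflect {i} {suc a} k<y))

    -- The next term of x is suc (x n) unless that number is y (suc a), in which
    -- case it is suc (suc (x n)) and a grows by one.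
    splits : ∀ n → ∃ (Splits n)
    splits zero = 0 , x-zero , ℕ.≤-reflexive (trans y-zero (sym x-zero)) ,
      subst (ℕ._< y 1) (sym x-zero) (ℕ.≤-<-trans ℕ.z≤n (x<y 0))
    splits (suc n) with splits n
    ... | a , x≡ , ya≤x , x<ya′ with suc (x n) ℕ.≟ y (suc a)
    ... | no  ≢y = a , trans x′≡ (cong suc x≡) ,
          ℕ.≤-trans ya≤x (ℕ.<⇒≤ (x-suc n)) , subst (ℕ._< y (suc a)) (sym x′≡) 1+x<y
      where
      1+x<y : suc (x n) ℕ.< y (suc a)
      1+x<y = ℕ.≤∧≢⇒< x<ya′ ≢y
      x′≡ : x (suc n) ≡ suc (x n)
      x′≡ = isMex-unique (x-mex n)
        (fresh n a _ ℕ.≤-refl (ℕ.s≤s ya≤x) 1+x<y , λ k k<1+x → ≤x⇒∈L n (ℕ.≤-pred k<1+x))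
    ... | yes ≡y = suc a , trans x′≡ (trans (cong (λ z → suc (suc z)) x≡) (cong suc (sym (ℕ.+-suc n a)))) ,
          subst₂ ℕ._≤_ ≡y (sym x′≡) (ℕ.n≤1+n _) , subst (ℕ._< y (suc (suc a))) (sym x′≡) 2+x<y
      where
      2+x<y : suc (suc (x n)) ℕ.< y (suc (suc a))
      2+x<y = subst (λ z → 2 ℕ.+ z ℕ.≤ y (suc (suc a))) (sym ≡y) (y-gap (suc a))
      -- The value y (suc a) = suc (x n) is already used: if n < suc a, then
      -- x (suc n) ≤ x (suc a) < y (suc a) = suc (x n).
      1+a≤n : suc a ℕ.≤ n
      1+a≤n = ℕ.≮⇒≥ λ n<1+a → ℕ.<⇒≱ (x-suc n)
        (ℕ.≤-pred (subst (x (suc n) ℕ.<_) (sym ≡y) (ℕ.≤-<-trans (x-mono n<1+a) (x<y a))))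
      below : ∀ k → k ℕ.< suc (suc (x n)) → k ∈ L (suc n)
      below k k<2+x with ℕ.m≤n⇒m<n∨m≡n (ℕ.≤-pred k<2+x)
      ... | inj₁ k<1+x = ≤x⇒∈L n (ℕ.≤-pred k<1+x)
      ... | inj₂ refl  = subst (_∈ L (suc n)) (sym ≡y) (y∈L (ℕ.≤⇒≤′ 1+a≤n))
      x′≡ : x (suc n) ≡ suc (suc (x n))
      x′≡ = isMex-unique (x-mex n)
        (fresh n (suc a) _ (ℕ.m≤n⇒m≤1+n ℕ.≤-refl) (subst (ℕ._< _) ≡y ℕ.≤-refl) 2+x<y , below)

------------------------------------------------------------------------
-- Order and arithmetic of the rational numbers

ℚ-ring : AlmostCommutativeRing _ _
ℚ-ring = fromCommutativeRing +-*-commutativeRing (λ q → dec⇒maybe (0ℚ ≟ q))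

p≤q⇒0≤q-p : ∀ {p q} → p ≤ q → 0ℚ ≤ q - p
p≤q⇒0≤q-p {p} {q} p≤q = subst (_≤ q - p) (+-inverseʳ p) (+-monoˡ-≤ (- p) p≤q)

-- Polynomial inequalities are certified by writing a difference as a sum of
-- products of nonnegative terms; _⊕_ and _⊗_ then build the proof of its
-- nonnegativity, in the shape of the certificate itself.
infixl 6 _⊕_
infixl 7 _⊗_

_⊕_ : ∀ {p q} → 0ℚ ≤ p → 0ℚ ≤ q → 0ℚ ≤ p + q
_⊕_ = +-mono-≤

_⊗_ : ∀ {p q} → 0ℚ ≤ p → 0ℚ ≤ q → 0ℚ ≤ p * q
_⊗_ {p} {q} 0≤p 0≤q = subst (_≤ p * q) (*-zeroʳ p) (*-monoˡ-≤-nonNeg p {{ℚ.nonNegative 0≤p}} 0≤q)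

≤-from : ∀ {p q c} → q - p ≡ c → 0ℚ ≤ c → p ≤ q
≤-from {p} {q} eq 0≤c = subst₂ _≤_ (+-identityˡ p) (cancel p q)
    (+-monoˡ-≤ p (subst (0ℚ ≤_) (sym eq) 0≤c))
  where
  cancel : ∀ p q → q - p + p ≡ q
  cancel = solve-∀ ℚ-ring

0≤-from-scaled : ∀ {s p c} → 0ℚ < s → s * p ≡ c → 0ℚ ≤ c → 0ℚ ≤ p
0≤-from-scaled {s} 0<s eq 0≤c =
  *-cancelˡ-≤-pos s {{ℚ.positive 0<s}} (subst₂ _≤_ (sym (*-zeroʳ s)) (sym eq) 0≤c)

≤-from-scaled : ∀ {s p q c} → 0ℚ < s → s * (q - p) ≡ c → 0ℚ ≤ c → p ≤ q
≤-from-scaled 0<s eq 0≤c = ≤-from refl (0≤-from-scaled 0<s eq 0≤c)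

0≤p*p : ∀ p → 0ℚ ≤ p * p
0≤p*p p with ≤-total 0ℚ p
... | inj₁ 0≤p = 0≤p ⊗ 0≤p
... | inj₂ p≤0 = subst (0ℚ ≤_) (neg-square p) (0≤-p ⊗ 0≤-p)
  where
  0≤-p = neg-antimono-≤ p≤0
  neg-square : ∀ p → - p * - p ≡ p * p
  neg-square = solve-∀ ℚ-ring

∣∣-≤ : ∀ {p q} → p ≤ q → - p ≤ q → ∣ p ∣ ≤ q
∣∣-≤ {p} p≤q -p≤q with ∣p∣≡p∨∣p∣≡-p p
... | inj₁ eq = subst (_≤ _) (sym eq) p≤q
... | inj₂ eq = subst (_≤ _) (sym eq) -p≤q

p≤∣p∣ : ∀ p → p ≤ ∣ p ∣
p≤∣p∣ p with ≤-total 0ℚ p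
... | inj₁ 0≤p = ≤-reflexive (sym (0≤p⇒∣p∣≡p 0≤p))
... | inj₂ p≤0 = ≤-trans p≤0 (0≤∣p∣ p)

-p≤∣p∣ : ∀ p → - p ≤ ∣ p ∣
-p≤∣p∣ p = subst (- p ≤_) (∣-p∣≡∣p∣ p) (p≤∣p∣ (- p))

fromℕ : ℕ → ℚ
fromℕ n = ℤ.+ n / 1

toℚᵘ-/ : ∀ i d → ℚ.toℚᵘ (i / suc d) ℚᵘ.≃ ℚᵘ.mkℚᵘ i d
toℚᵘ-/ i d = toℚᵘ-fromℚᵘ (ℚᵘ.mkℚᵘ i d)

fromℕ-+ : ∀ m n → fromℕ (m ℕ.+ n) ≡ fromℕ m + fromℕ n
fromℕ-+ m n = toℚᵘ-injective (begin
  ℚ.toℚᵘ (fromℕ (m ℕ.+ n))                  ≈⟨ toℚᵘ-/ (ℤ.+ (m ℕ.+ n)) 0 ⟩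
  ℚᵘ.mkℚᵘ (ℤ.+ (m ℕ.+ n)) 0                 ≈⟨ ℚᵘ.*≡* (cong (ℤ._* ℤ.+ 1) (sym (cong₂ ℤ._+_ (ℤ.*-identityʳ (ℤ.+ m)) (ℤ.*-identityʳ (ℤ.+ n))))) ⟩
  ℚᵘ.mkℚᵘ (ℤ.+ m) 0 ℚᵘ.+ ℚᵘ.mkℚᵘ (ℤ.+ n) 0  ≈⟨ ℚᵘ.+-cong (ℚᵘ.≃-sym (toℚᵘ-/ (ℤ.+ m) 0)) (ℚᵘ.≃-sym (toℚᵘ-/ (ℤ.+ n) 0)) ⟩
  ℚ.toℚᵘ (fromℕ m) ℚᵘ.+ ℚ.toℚᵘ (fromℕ n)    ≈⟨ toℚᵘ-homo-+ (fromℕ m) (fromℕ n) ⟨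
  ℚ.toℚᵘ (fromℕ m + fromℕ n)                ∎)
  where open ℚᵘ.≃-Reasoning

0≤fromℕ : ∀ n → 0ℚ ≤ fromℕ n
0≤fromℕ n = nonNegative⁻¹ (fromℕ n) {{normalize-nonNeg n 1}}

fromℕ-mono : ∀ {m n} → m ℕ.≤ n → fromℕ m ≤ fromℕ n
fromℕ-mono {m} {n} m≤n = subst₂ _≤_ (+-identityʳ (fromℕ m))
  (trans (sym (fromℕ-+ m (n ℕ.∸ m))) (cong fromℕ (ℕ.m+[n∸m]≡n m≤n)))
  (+-monoʳ-≤ (fromℕ m) (0≤fromℕ (n ℕ.∸ m)))

/-*-cancel : ∀ m n .{{_ : ℕ.NonZero n}} → (ℤ.+ m / n) * fromℕ n ≡ fromℕ m
/-*-cancel m n@(suc d) = toℚᵘ-injective (begin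
  ℚ.toℚᵘ ((ℤ.+ m / n) * fromℕ n)              ≈⟨ toℚᵘ-homo-* (ℤ.+ m / n) (fromℕ n) ⟩
  ℚ.toℚᵘ (ℤ.+ m / n) ℚᵘ.* ℚ.toℚᵘ (fromℕ n)    ≈⟨ ℚᵘ.*-cong (toℚᵘ-/ (ℤ.+ m) d) (toℚᵘ-/ (ℤ.+ n) 0) ⟩
  ℚᵘ.mkℚᵘ (ℤ.+ m) d ℚᵘ.* ℚᵘ.mkℚᵘ (ℤ.+ n) 0    ≈⟨ ℚᵘ.*≡* (trans (ℤ.*-identityʳ _) (cong (ℤ.+ m ℤ.*_) (cong ℤ.+_ (sym (ℕ.*-identityʳ n))))) ⟩
  ℚᵘ.mkℚᵘ (ℤ.+ m) 0                           ≈⟨ ℚᵘ.≃-sym (toℚᵘ-/ (ℤ.+ m) 0) ⟩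
  ℚ.toℚᵘ (fromℕ m)                            ∎)
  where open ℚᵘ.≃-Reasoning

fromℕ-suc : ∀ n → fromℕ (suc n) ≡ fromℕ n + 1ℚ
fromℕ-suc n = trans (cong fromℕ (ℕ.+-comm 1 n)) (fromℕ-+ n 1)

fromℕ-* : ∀ m n → fromℕ (m ℕ.* n) ≡ fromℕ m * fromℕ n
fromℕ-* zero    n = sym (*-zeroˡ (fromℕ n))
fromℕ-* (suc m) n = begin
  fromℕ (n ℕ.+ m ℕ.* n)            ≡⟨ fromℕ-+ n (m ℕ.* n) ⟩
  fromℕ n + fromℕ (m ℕ.* n)        ≡⟨ cong (λ z → fromℕ n + z) (fromℕ-* m n) ⟩
  fromℕ n + fromℕ m * fromℕ n      ≡⟨ distrib (fromℕ m) (fromℕ n) ⟩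
  (fromℕ m + 1ℚ) * fromℕ n         ≡⟨ cong (_* fromℕ n) (fromℕ-suc m) ⟨
  fromℕ (suc m) * fromℕ n          ∎
  where
  open ≡-Reasoning
  distrib : ∀ p q → q + p * q ≡ (p + 1ℚ) * q
  distrib = solve-∀ ℚ-ring

0≤fromℕ-diff : ∀ {m n} → m ℕ.≤ n → 0ℚ ≤ fromℕ n - fromℕ m
0≤fromℕ-diff m≤n = p≤q⇒0≤q-p (fromℕ-mono m≤n)

archimedean : ∀ ε → 0ℚ < ε → ∃[ n ] 1ℚ ≤ fromℕ (suc n) * ε
archimedean ε@(mkℚ (ℤ.+ zero) _ _) 0<ε with () ← ℚ.positive 0<ε
archimedean ε@(mkℚ ℤ.-[1+ _ ] _ _) 0<ε with () ← ℚ.positive 0<ε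
archimedean ε@(mkℚ ℤ.+[1+ a ] d _) 0<ε = d , subst (1ℚ ≤_) eq (fromℕ-mono {1} {suc a} (ℕ.s≤s ℕ.z≤n))
  where
  eq : fromℕ (suc a) ≡ fromℕ (suc d) * ε
  eq = sym (trans (*-comm (fromℕ (suc d)) ε)
         (trans (cong (_* fromℕ (suc d)) (sym (↥p/↧p≡p ε))) (/-*-cancel (suc a) (suc d))))

-- The rational number ε = 1/d for a natural number d = suc d-1.
module Reciprocal (d-1 : ℕ) where

  d : ℕ
  d = suc d-1

  ε : ℚ
  ε = ℤ.+ 1 / d

  ε*d≡1 : ε * fromℕ d ≡ 1ℚ
  ε*d≡1 = /-*-cancel 1 d

  0≤ε : 0ℚ ≤ ε
  0≤ε = nonNegative⁻¹ ε {{normalize-nonNeg 1 d}}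

  0<ε : 0ℚ < ε
  0<ε = positive⁻¹ ε {{normalize-pos 1 d}}

  ≤ε* : ∀ k {t} → fromℕ (k ℕ.* d) ≤ t → fromℕ k ≤ ε * t
  ≤ε* k {t} kd≤t = subst (_≤ ε * t) eq (*-monoˡ-≤-nonNeg ε {{ℚ.nonNegative 0≤ε}} kd≤t)
    where
    rearrange : ∀ e k d → e * (k * d) ≡ k * (e * d)
    rearrange = solve-∀ ℚ-ring
    eq : ε * fromℕ (k ℕ.* d) ≡ fromℕ k
    eq = trans (cong (ε *_) (fromℕ-* k d)) (trans (rearrange ε (fromℕ k) (fromℕ d))
           (trans (cong (fromℕ k *_) ε*d≡1) (*-identityʳ (fromℕ k))))

  ε≤1 : ε ≤ 1ℚ
  ε≤1 = subst₂ _≤_ (*-identityʳ ε) ε*d≡1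
    (*-monoˡ-≤-nonNeg ε {{ℚ.nonNegative 0≤ε}} (fromℕ-mono {1} {d} (ℕ.s≤s ℕ.z≤n)))

------------------------------------------------------------------------
-- Propagation of the error bounds

-- The Tribonacci polynomial.
cubic : ℚ → ℚ
cubic t = t * t * t - (t * t + t + 1ℚ)

-- Here r stands for an approximation of the root and E for the error allowed,
-- while n, x, m stand for an index and for the values of the first and third
-- sequence at that index.
module Estimates (r ε C : ℚ) (3/2≤r : ℤ.+ 3 / 2 ≤ r) (r≤2 : r ≤ fromℕ 2)
                 (0≤ε : 0ℚ ≤ ε) (0≤C : 0ℚ ≤ C) where

  E : ℚ → ℚ
  E n = ε * n + C

  -- The deviations of x from (r + 1)n/r and of m from (r² - 1)n/r, times r.
  U V : ℚ → ℚ → ℚ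
  U n x = r * x - (r + 1ℚ) * n
  V n m = r * m - (r * r - 1ℚ) * n

  -- The deviations U and V at the index n are at most E n and (r - 1) E n in
  -- absolute value; the weights are the components of the eigenvector
  -- (1, r - 1).
  record Good (n x m : ℚ) : Set where
    field
      U≤ : 0ℚ ≤ E n - U n x
      U≥ : 0ℚ ≤ E n + U n x
      V≤ : 0ℚ ≤ (r - 1ℚ) * E n - V n m
      V≥ : 0ℚ ≤ (r - 1ℚ) * E n + V n m

  0≤r-3/2 : 0ℚ ≤ r - ℤ.+ 3 / 2
  0≤r-3/2 = p≤q⇒0≤q-p 3/2≤r

  0≤2-r : 0ℚ ≤ fromℕ 2 - r
  0≤2-r = p≤q⇒0≤q-p r≤2

  0<r : 0ℚ < r
  0<r = <-≤-trans (positive⁻¹ (ℤ.+ 3 / 2)) 3/2≤r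

  0≤r : 0ℚ ≤ r
  0≤r = <⇒≤ 0<r

  0<r*r : 0ℚ < r * r
  0<r*r = positive⁻¹ (r * r) {{pos*pos⇒pos r {{ℚ.positive 0<r}} r {{ℚ.positive 0<r}}}}

  0≤1 : 0ℚ ≤ 1ℚ
  0≤1 = 0≤fromℕ 1

  0≤r-1 : 0ℚ ≤ r - 1ℚ
  0≤r-1 = subst (0ℚ ≤_) (id r) (0≤r-3/2 ⊕ nonNegative⁻¹ ½)
    where
    id : ∀ r → r - ℤ.+ 3 / 2 + ½ ≡ r - 1ℚ
    id = solve-∀ ℚ-ring

  0≤E : ∀ {n} → 0ℚ ≤ n → 0ℚ ≤ E n
  0≤E 0≤n = 0≤ε ⊗ 0≤n ⊕ 0≤C

  -- In the next four lemmas x and m are the values of the first and third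
  -- sequence at the index a (or a + 1, b, b + 1), so that x + m and
  -- x + (x + m) are those of the second and fourth, while n + a and n + b are
  -- the values of the first and third sequence at the index n.
  U-upper : ∀ n a {x m} → Good a x m → 0ℚ ≤ (n + a) - (x + m) → 0ℚ ≤ n - a → 0ℚ ≤ E n - U n (n + a)
  U-upper n a {x} {m} g h a≤n = 0≤-from-scaled 0<r (id r ε C n a x m)
    (0≤r ⊗ (0≤ε ⊗ a≤n) ⊕ (Good.U≥ g ⊕ Good.V≥ g) ⊕ 0≤r ⊗ h)
    where
    id : ∀ r ε C n a x m →
      let E = λ (n : ℚ) → ε * n + C
          U = λ (n x : ℚ) → r * x - (r + 1ℚ) * n
          V = λ (n m : ℚ) → r * m - (r * r - 1ℚ) * n
      in r * (E n - U n (n + a)) ≡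
         r * (ε * (n - a)) + ((E a + U a x) + ((r - 1ℚ) * E a + V a m)) + r * ((n + a) - (x + m))
    id = solve-∀ ℚ-ring

  U-lower : ∀ n a {x m} → Good (a + 1ℚ) x m → 0ℚ ≤ (x + m) - (n + (a + 1ℚ)) →
            0ℚ ≤ ε * (n - (a + 1ℚ)) - r → 0ℚ ≤ E n + U n (n + a)
  U-lower n a {x} {m} g h gap = 0≤-from-scaled 0<r (id r ε C n a x m)
    (0≤r ⊗ gap ⊕ (Good.U≤ g ⊕ Good.V≤ g) ⊕ 0≤r ⊗ h)
    where
    id : ∀ r ε C n a x m →
      let E = λ (n : ℚ) → ε * n + C
          U = λ (n x : ℚ) → r * x - (r + 1ℚ) * n
          V = λ (n m : ℚ) → r * m - (r * r - 1ℚ) * n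
          a′ = a + 1ℚ
      in r * (E n + U n (n + a)) ≡
         r * (ε * (n - a′) - r) + ((E a′ - U a′ x) + ((r - 1ℚ) * E a′ - V a′ m)) + r * ((x + m) - (n + a′))
    id = solve-∀ ℚ-ring

  -- The errors at b contribute (r + 1) E b to r² V, and the weights allow for
  -- it because r²(r - 1) = r + 1 + cubic r ≥ r + 1.
  V-upper : ∀ n b {x m} → 0ℚ ≤ cubic r → Good b x m → 0ℚ ≤ (n + b) - (x + (x + m)) → 0ℚ ≤ n → 0ℚ ≤ n - b →
            0ℚ ≤ (r - 1ℚ) * E n - V n (n + b)
  V-upper n b {x} {m} 0≤f g h 0≤n b≤n = 0≤-from-scaled 0<r*r (id r ε C n b x m)
    ((0≤r ⊕ 0≤1) ⊗ (0≤ε ⊗ b≤n) ⊕ (Good.U≥ g ⊕ Good.U≥ g ⊕ Good.V≥ g) ⊕ 0≤r ⊗ h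
      ⊕ 0≤f ⊗ (0≤E 0≤n ⊕ 0≤r-1 ⊗ 0≤n ⊕ b≤n))
    where
    id : ∀ r ε C n b x m →
      let E = λ (n : ℚ) → ε * n + C
          U = λ (n x : ℚ) → r * x - (r + 1ℚ) * n
          V = λ (n m : ℚ) → r * m - (r * r - 1ℚ) * n
          f = r * r * r - (r * r + r + 1ℚ)
      in (r * r) * ((r - 1ℚ) * E n - V n (n + b)) ≡
         (r + 1ℚ) * (ε * (n - b)) + ((E b + U b x) + (E b + U b x) + ((r - 1ℚ) * E b + V b m))
           + r * ((n + b) - (x + (x + m))) + f * (E n + (r - 1ℚ) * n + (n - b))
    id = solve-∀ ℚ-ring

  -- Besides the errors at b + 1 there is a loss of at most r (cubic r) n + r³,
  -- covered by the gain (r + 1)ε(n - (b + 1)) since cubic r ≤ ε/4, 2b ≤ n and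
  -- εn ≥ 20.  The scaling by 4 keeps the certificate free of fractions.
  V-lower : ∀ n b {x m} → 0ℚ ≤ cubic r → 0ℚ ≤ ε - fromℕ 4 * cubic r → 0ℚ ≤ 1ℚ - ε →
            Good (b + 1ℚ) x m → 0ℚ ≤ (x + (x + m)) - (n + (b + 1ℚ)) →
            0ℚ ≤ n → 0ℚ ≤ b → 0ℚ ≤ n - (b + b) → 0ℚ ≤ ε * n - fromℕ 20 →
            0ℚ ≤ (r - 1ℚ) * E n + V n (n + b)
  V-lower n b {x} {m} 0≤f f≤ ε≤1 g h 0≤n 0≤b 2b≤n n-large =
    0≤-from-scaled 0<r*r refl
    (0≤-from-scaled (positive⁻¹ (fromℕ 4)) (id r ε C n b x m)
    (0≤4 ⊗ (Good.U≤ g ⊕ Good.U≤ g ⊕ Good.V≤ g) ⊕ 0≤4 ⊗ (0≤r ⊗ h)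
      ⊕ 0≤4 ⊗ (0≤f ⊗ (0≤E 0≤n ⊕ (0≤b ⊕ 0≤1)))
      ⊕ (0≤r ⊗ f≤ ⊗ 0≤n ⊕ (0≤r ⊕ 0≤fromℕ 2) ⊗ n-large ⊕ 0≤4 ⊗ ((0≤r ⊕ 0≤1) ⊗ ε≤1)
         ⊕ 0≤fromℕ 2 ⊗ ((0≤r ⊕ 0≤1) ⊗ (0≤ε ⊗ 2b≤n))
         ⊕ 0≤4 ⊗ (0≤2-r ⊗ (0≤4 ⊕ 0≤fromℕ 2 ⊗ 0≤r ⊕ 0≤r ⊗ 0≤r)) ⊕ 0≤fromℕ 16 ⊗ 0≤r ⊕ 0≤4)))
    where
    0≤4 = 0≤fromℕ 4
    id : ∀ r ε C n b x m →
      let E = λ (n : ℚ) → ε * n + C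
          U = λ (n x : ℚ) → r * x - (r + 1ℚ) * n
          V = λ (n m : ℚ) → r * m - (r * r - 1ℚ) * n
          f = r * r * r - (r * r + r + 1ℚ)
          b′ = b + 1ℚ
      in fromℕ 4 * ((r * r) * ((r - 1ℚ) * E n + V n (n + b))) ≡
         fromℕ 4 * ((E b′ - U b′ x) + (E b′ - U b′ x) + ((r - 1ℚ) * E b′ - V b′ m))
           + fromℕ 4 * (r * ((x + (x + m)) - (n + b′)))
           + fromℕ 4 * (f * (E n + b′))
           + (r * (ε - fromℕ 4 * f) * n + (r + fromℕ 2) * (ε * n - fromℕ 20) + fromℕ 4 * ((r + 1ℚ) * (1ℚ - ε))
              + fromℕ 2 * ((r + 1ℚ) * (ε * (n - (b + b))))
              + fromℕ 4 * ((fromℕ 2 - r) * (fromℕ 4 + fromℕ 2 * r + r * r)) + fromℕ 16 * r + fromℕ 4)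
    id = solve-∀ ℚ-ring

  -- On an initial segment the constant part C = 8N of E is enough.
  initial : ∀ n a b N → 0ℚ ≤ a → 0ℚ ≤ n - a → 0ℚ ≤ b → 0ℚ ≤ n - b → 0ℚ ≤ n → 0ℚ ≤ N - n →
            C ≡ fromℕ 8 * N → Good n (n + a) (n + b)
  initial n a b N 0≤a a≤n 0≤b b≤n 0≤n n≤N refl = record
    { U≤ = subst (0ℚ ≤_) (U≤-id r ε n a N)
        (0≤ε ⊗ 0≤n ⊕ 0≤fromℕ 8 ⊗ n≤N ⊕ 0≤2-r ⊗ 0≤a ⊕ 0≤fromℕ 2 ⊗ a≤n ⊕ 0≤fromℕ 7 ⊗ 0≤n)
    ; U≥ = subst (0ℚ ≤_) (U≥-id r ε n a N)
        (0≤ε ⊗ 0≤n ⊕ 0≤fromℕ 8 ⊗ n≤N ⊕ 0≤fromℕ 7 ⊗ 0≤n ⊕ 0≤r ⊗ 0≤a)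
    ; V≤ = subst (0ℚ ≤_) (V≤-id r ε n b N)
        (0≤r-1 ⊗ (0≤ε ⊗ 0≤n ⊕ 0≤fromℕ 8 ⊗ n≤N) ⊕ 0≤r ⊗ b≤n
          ⊕ (0≤r-3/2 ⊗ 0≤r-3/2 ⊕ 0≤fromℕ 9 ⊗ 0≤r-3/2 ⊕ nonNegative⁻¹ (ℤ.+ 9 / 4)) ⊗ 0≤n)
    ; V≥ = subst (0ℚ ≤_) (V≥-id r ε n b N)
        (0≤r-1 ⊗ (0≤ε ⊗ 0≤n ⊕ 0≤fromℕ 8 ⊗ n≤N) ⊕ 0≤r ⊗ 0≤b
          ⊕ (0≤r-3/2 ⊗ 0≤2-r ⊕ nonNegative⁻¹ (ℤ.+ 11 / 2) ⊗ 0≤r-3/2 ⊕ nonNegative⁻¹ (ℤ.+ 17 / 4)) ⊗ 0≤n)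
    }
    where
    U≤-id : ∀ r ε n a N →
      ε * n + fromℕ 8 * (N - n) + (fromℕ 2 - r) * a + fromℕ 2 * (n - a) + fromℕ 7 * n
        ≡ (ε * n + fromℕ 8 * N) - (r * (n + a) - (r + 1ℚ) * n)
    U≤-id = solve-∀ ℚ-ring
    U≥-id : ∀ r ε n a N →
      ε * n + fromℕ 8 * (N - n) + fromℕ 7 * n + r * a
        ≡ (ε * n + fromℕ 8 * N) + (r * (n + a) - (r + 1ℚ) * n)
    U≥-id = solve-∀ ℚ-ring
    V≤-id : ∀ r ε n b N → let s = r - ℤ.+ 3 / 2 in
      (r - 1ℚ) * (ε * n + fromℕ 8 * (N - n)) + r * (n - b) + (s * s + fromℕ 9 * s + ℤ.+ 9 / 4) * n
        ≡ (r - 1ℚ) * (ε * n + fromℕ 8 * N) - (r * (n + b) - (r * r - 1ℚ) * n)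
    V≤-id = solve-∀ ℚ-ring
    V≥-id : ∀ r ε n b N → let s = r - ℤ.+ 3 / 2 in
      (r - 1ℚ) * (ε * n + fromℕ 8 * (N - n)) + r * b + (s * (fromℕ 2 - r) + ℤ.+ 11 / 2 * s + ℤ.+ 17 / 4) * n
        ≡ (r - 1ℚ) * (ε * n + fromℕ 8 * N) + (r * (n + b) - (r * r - 1ℚ) * n)
    V≥-id = solve-∀ ℚ-ring

  -- r times (x + m) - r x is V - (r - 1) U.
  ratio : ∀ {n x m} → 0ℚ ≤ n → Good n x m → ∣ (x + m) - r * x ∣ ≤ E n + E n
  ratio {n} {x} {m} 0≤n g = ∣∣-≤
    (≤-from-scaled 0<r (id₁ r ε C n x m) (Good.V≤ g ⊕ 0≤r-1 ⊗ Good.U≥ g ⊕ (0≤E 0≤n ⊕ 0≤E 0≤n)))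
    (≤-from-scaled 0<r (id₂ r ε C n x m) (Good.V≥ g ⊕ 0≤r-1 ⊗ Good.U≤ g ⊕ (0≤E 0≤n ⊕ 0≤E 0≤n)))
    where
    id₁ : ∀ r ε C n x m →
      let E = λ (n : ℚ) → ε * n + C
          U = λ (n x : ℚ) → r * x - (r + 1ℚ) * n
          V = λ (n m : ℚ) → r * m - (r * r - 1ℚ) * n
      in r * ((E n + E n) - ((x + m) - r * x)) ≡
         ((r - 1ℚ) * E n - V n m) + (r - 1ℚ) * (E n + U n x) + (E n + E n)
    id₁ = solve-∀ ℚ-ring
    id₂ : ∀ r ε C n x m →
      let E = λ (n : ℚ) → ε * n + C
          U = λ (n x : ℚ) → r * x - (r + 1ℚ) * n
          V = λ (n m : ℚ) → r * m - (r * r - 1ℚ) * n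
      in r * ((E n + E n) - - ((x + m) - r * x)) ≡
         ((r - 1ℚ) * E n + V n m) + (r - 1ℚ) * (E n - U n x) + (E n + E n)
    id₂ = solve-∀ ℚ-ring

------------------------------------------------------------------------
-- Rational approximations of the root from above

-- For c = 7/4 and c = 19/10 the quadratic factor of cubic t - cubic c is
-- positive for every t; the value of cubic is below -1/4 at 7/4 and above 1/4
-- at 19/10.
cubic-large⇒7/4≤ : ∀ {t} → - cubic t < ℤ.+ 1 / 4 → ℤ.+ 7 / 4 ≤ t
cubic-large⇒7/4≤ {t} cubic-large = ≮⇒≥ λ t<7/4 → <-irrefl refl (<-≤-trans
  (<-trans cubic-large (toWitness {a? = ℤ.+ 1 / 4 <? - cubic (ℤ.+ 7 / 4)} _))
  (neg-antimono-≤ {cubic t} {cubic (ℤ.+ 7 / 4)} (≤-from (id t)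
    (p≤q⇒0≤q-p (<⇒≤ t<7/4) ⊗ (0≤p*p (t + ℤ.+ 3 / 8) ⊕ nonNegative⁻¹ (ℤ.+ 11 / 64))))))
  where
  id : ∀ t → let c = ℤ.+ 7 / 4 in
    (c * c * c - (c * c + c + 1ℚ)) - (t * t * t - (t * t + t + 1ℚ)) ≡
    (c - t) * ((t + ℤ.+ 3 / 8) * (t + ℤ.+ 3 / 8) + ℤ.+ 11 / 64)
  id = solve-∀ ℚ-ring

cubic-small⇒≤19/10 : ∀ {t} → cubic t < ℤ.+ 1 / 4 → t ≤ ℤ.+ 19 / 10
cubic-small⇒≤19/10 {t} cubic-small = ≮⇒≥ λ 19/10<t → <-irrefl refl (<-≤-trans
  (<-trans cubic-small (toWitness {a? = ℤ.+ 1 / 4 <? cubic (ℤ.+ 19 / 10)} _))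
  (≤-from (id t) (p≤q⇒0≤q-p (<⇒≤ 19/10<t) ⊗
    (0≤p*p (t + ℤ.+ 9 / 20) ⊕ nonNegative⁻¹ (ℤ.+ 203 / 400)))))
  where
  id : ∀ t → let c = ℤ.+ 19 / 10 in
    (t * t * t - (t * t + t + 1ℚ)) - (c * c * c - (c * c + c + 1ℚ)) ≡
    (t - c) * ((t + ℤ.+ 9 / 20) * (t + ℤ.+ 9 / 20) + ℤ.+ 203 / 400)
  id = solve-∀ ℚ-ring

-- If |cubic t| ≤ s with t between 7/4 and 2, then moving up by s makes cubic
-- nonnegative, its mean slope between t and t + s being at least 1, and at most
-- 10 s, that slope being at most 9.
module Overshoot (t s : ℚ) (7/4≤t : ℤ.+ 7 / 4 ≤ t) (t≤2 : t ≤ fromℕ 2) (0≤s : 0ℚ ≤ s) (s≤1/4 : s ≤ ℤ.+ 1 / 4)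
                 (root : ∣ cubic t ∣ ≤ s) where

  0≤u : 0ℚ ≤ t - ℤ.+ 7 / 4
  0≤u = p≤q⇒0≤q-p 7/4≤t

  0≤cubic : 0ℚ ≤ cubic (t + s)
  0≤cubic = subst (0ℚ ≤_) (id t s) (p≤q⇒0≤q-p (≤-trans (-p≤∣p∣ (cubic t)) root)
    ⊕ 0≤s ⊗ (0≤fromℕ 3 ⊗ 0≤p*p (t - ℤ.+ 7 / 4) ⊕ nonNegative⁻¹ (ℤ.+ 17 / 2) ⊗ 0≤u ⊕ nonNegative⁻¹ (ℤ.+ 59 / 16)
      ⊕ 0≤s ⊗ (0≤fromℕ 3 ⊗ 0≤u ⊕ nonNegative⁻¹ (ℤ.+ 17 / 4)) ⊕ 0≤p*p s))
    where
    id : ∀ t s →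
      let f = λ (t : ℚ) → t * t * t - (t * t + t + 1ℚ)
          u = t - ℤ.+ 7 / 4
      in (s - - f t) + s * (fromℕ 3 * (u * u) + ℤ.+ 17 / 2 * u + ℤ.+ 59 / 16
           + s * (fromℕ 3 * u + ℤ.+ 17 / 4) + s * s) ≡ f (t + s)
    id = solve-∀ ℚ-ring

  cubic≤ : cubic (t + s) ≤ fromℕ 10 * s
  cubic≤ = ≤-from (id t s) (p≤q⇒0≤q-p (≤-trans (p≤∣p∣ (cubic t)) root)
    ⊕ 0≤s ⊗ (0≤v ⊗ (0≤fromℕ 4 ⊕ 0≤fromℕ 3 ⊗ 0≤t) ⊕ 0≤fromℕ 3 ⊗ 0≤v ⊗ 0≤s
      ⊕ p≤q⇒0≤q-p s≤1/4 ⊗ (0≤s ⊕ nonNegative⁻¹ (ℤ.+ 21 / 4)) ⊕ nonNegative⁻¹ (ℤ.+ 11 / 16)))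
    where
    0≤v : 0ℚ ≤ fromℕ 2 - t
    0≤v = p≤q⇒0≤q-p t≤2
    0≤t : 0ℚ ≤ t
    0≤t = ≤-trans (nonNegative⁻¹ (ℤ.+ 7 / 4)) 7/4≤t
    id : ∀ t s →
      let f = λ (t : ℚ) → t * t * t - (t * t + t + 1ℚ)
          v = fromℕ 2 - t
      in fromℕ 10 * s - f (t + s) ≡ (s - f t) + s * (v * (fromℕ 4 + fromℕ 3 * t) + fromℕ 3 * v * s
           + (ℤ.+ 1 / 4 - s) * (s + ℤ.+ 21 / 4) + ℤ.+ 11 / 16)
    id = solve-∀ ℚ-ring

-- A rational number r between 3/2 and 2 with 0 ≤ cubic r ≤ ε/4 that is within
-- 2ε of the terms of ψ from the index start on, where ε = 1/d and d = suc d-1.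
record UpperApprox (ψ : ℝ) (d-1 : ℕ) : Set where
  field
    r        : ℚ
    3/2≤r    : ℤ.+ 3 / 2 ≤ r
    r≤2      : r ≤ fromℕ 2
    0≤f      : 0ℚ ≤ cubic r
    f-small  : fromℕ 4 * cubic r ≤ ℤ.+ 1 / suc d-1
    start    : ℕ
    near     : ∀ k → start ℕ.≤ k → ∣ r - seq ψ k ∣ ≤ fromℕ 2 * (ℤ.+ 1 / suc d-1)

upperApprox : ∀ ψ → IsTribonacciRoot ψ → ∀ d-1 → UpperApprox ψ d-1
upperApprox ψ isRoot d-1 = approx (isRoot s 0<s) (cauchy ψ ε 0<ε)
  where
  open Reciprocal d-1

  -- The overshoot bound 10 s has to be at most ε/4.
  s : ℚ
  s = ℤ.+ 1 / 40 * ε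

  0<s : 0ℚ < s
  0<s = positive⁻¹ s {{pos*pos⇒pos (ℤ.+ 1 / 40) ε {{ℚ.positive 0<ε}}}}

  s≤1/40 : s ≤ ℤ.+ 1 / 40
  s≤1/40 = subst (s ≤_) (*-identityʳ (ℤ.+ 1 / 40)) (*-monoˡ-≤-nonNeg (ℤ.+ 1 / 40) ε≤1)

  s≤ε : s ≤ ε
  s≤ε = ≤-from (id ε) (nonNegative⁻¹ (ℤ.+ 39 / 40) ⊗ 0≤ε)
    where
    id : ∀ e → e - ℤ.+ 1 / 40 * e ≡ ℤ.+ 39 / 40 * e
    id = solve-∀ ℚ-ring

  40s≡ε : fromℕ 4 * (fromℕ 10 * s) ≡ ε
  40s≡ε = id ε
    where
    id : ∀ e → fromℕ 4 * (fromℕ 10 * (ℤ.+ 1 / 40 * e)) ≡ e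
    id = solve-∀ ℚ-ring

  s<1/4 : s < ℤ.+ 1 / 4
  s<1/4 = ≤-<-trans s≤1/40 (toWitness {a? = ℤ.+ 1 / 40 <? ℤ.+ 1 / 4} _)

  approx : (∃[ A ] ∀ n → A ℕ.≤ n → ∣ cubic (seq ψ n) ∣ < s) →
           (∃[ B ] ∀ m n → B ℕ.≤ m → B ℕ.≤ n → ∣ seq ψ m - seq ψ n ∣ < ε) → UpperApprox ψ d-1
  approx (A , root) (B , close) = record
    { r       = t + s
    ; 3/2≤r   = ≤-trans (toWitness {a? = ℤ.+ 3 / 2 ≤? ℤ.+ 7 / 4} _)
                  (subst (_≤ t + s) (+-identityʳ (ℤ.+ 7 / 4)) (+-mono-≤ 7/4≤t (<⇒≤ 0<s)))
    ; r≤2     = ≤-trans (+-mono-≤ t≤19/10 s≤1/40) (toWitness {a? = ℤ.+ 19 / 10 + ℤ.+ 1 / 40 ≤? fromℕ 2} _)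
    ; 0≤f     = 0≤cubic
    ; f-small = subst (fromℕ 4 * cubic (t + s) ≤_) 40s≡ε (*-monoˡ-≤-nonNeg (fromℕ 4) cubic≤)
    ; start   = K
    ; near    = λ k K≤k → begin
        ∣ t + s - seq ψ k ∣              ≡⟨ cong ∣_∣ (regroup t s (seq ψ k)) ⟩
        ∣ (t - seq ψ k) + s ∣            ≤⟨ ∣p+q∣≤∣p∣+∣q∣ (t - seq ψ k) s ⟩
        ∣ t - seq ψ k ∣ + ∣ s ∣          ≤⟨ +-mono-≤ (<⇒≤ (close K k B≤K (ℕ.≤-trans B≤K K≤k)))
                                             (≤-trans (≤-reflexive (0≤p⇒∣p∣≡p (<⇒≤ 0<s))) s≤ε) ⟩
        ε + ε                            ≡⟨ double ε ⟩
        fromℕ 2 * ε                      ∎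
    }
    where
    open ≤-Reasoning
    K = A ℕ.⊔ B
    t = seq ψ K

    B≤K : B ℕ.≤ K
    B≤K = ℕ.m≤n⊔m A B

    ∣cubic∣<s : ∣ cubic t ∣ < s
    ∣cubic∣<s = root K (ℕ.m≤m⊔n A B)

    7/4≤t : ℤ.+ 7 / 4 ≤ t
    7/4≤t = cubic-large⇒7/4≤ (≤-<-trans (-p≤∣p∣ (cubic t)) (<-trans ∣cubic∣<s s<1/4))

    t≤19/10 : t ≤ ℤ.+ 19 / 10
    t≤19/10 = cubic-small⇒≤19/10 (≤-<-trans (p≤∣p∣ (cubic t)) (<-trans ∣cubic∣<s s<1/4))

    open Overshoot t s 7/4≤t (≤-trans t≤19/10 (toWitness {a? = ℤ.+ 19 / 10 ≤? fromℕ 2} _))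
      (<⇒≤ 0<s) (<⇒≤ s<1/4) (<⇒≤ ∣cubic∣<s)

    regroup : ∀ t s p → t + s - p ≡ (t - p) + s
    regroup = solve-∀ ℚ-ring
    double : ∀ e → e + e ≡ fromℕ 2 * e
    double = solve-∀ ℚ-ring

------------------------------------------------------------------------
-- Convergence of the ratio

-- Sequences x, y, m, p with the defining properties of X, Y, M, P, where L and
-- K stand for the lists XY and MP.  Abstracting from the definitions prevents
-- the mex computations from being unfolded during type checking.
module MexQuadruple (x y m p : ℕ → ℕ) (L K : ℕ → List ℕ)
  (L-zero : L 0 ≡ []) (L-suc : ∀ n → L (suc n) ≡ x n ∷ y n ∷ L n)
  (K-zero : K 0 ≡ []) (K-suc : ∀ n → K (suc n) ≡ m n ∷ p n ∷ K n)
  (x-zero : x 0 ≡ 0) (x-mex : ∀ n → IsMex (L (suc n)) (x (suc n)))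
  (m-zero : m 0 ≡ 0) (m-mex : ∀ n → IsMex (K (suc n)) (m (suc n)))
  (y≡x+m : ∀ n → y n ≡ x n ℕ.+ m n) (p≡x+y : ∀ n → p n ≡ x n ℕ.+ y n)
  where

  open Greedy x y L L-zero L-suc x-zero x-mex using (x-suc; n≤x; module Counting)
  module GM = Greedy m p K K-zero K-suc m-zero m-mex

  n≤m : ∀ n → n ℕ.≤ m n
  n≤m = GM.n≤x

  y-zero : y 0 ≡ 0
  y-zero = trans (y≡x+m 0) (cong₂ ℕ._+_ x-zero m-zero)

  p-zero : p 0 ≡ 0
  p-zero = trans (p≡x+y 0) (cong₂ ℕ._+_ x-zero y-zero)

  y-gap : ∀ n → 2 ℕ.+ y n ℕ.≤ y (suc n)
  y-gap n = begin
    2 ℕ.+ y n                 ≡⟨ cong (2 ℕ.+_) (y≡x+m n) ⟩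
    2 ℕ.+ (x n ℕ.+ m n)       ≡⟨ cong suc (ℕ.+-suc (x n) (m n)) ⟨
    suc (x n) ℕ.+ suc (m n)   ≤⟨ ℕ.+-mono-≤ (x-suc n) (GM.x-suc n) ⟩
    x (suc n) ℕ.+ m (suc n)   ≡⟨ y≡x+m (suc n) ⟨
    y (suc n)                 ∎
    where open ℕ.≤-Reasoning

  p-gap : ∀ n → 2 ℕ.+ p n ℕ.≤ p (suc n)
  p-gap n = begin
    2 ℕ.+ p n                 ≡⟨ cong (2 ℕ.+_) (p≡x+y n) ⟩
    2 ℕ.+ (x n ℕ.+ y n)       ≡⟨ cong suc (ℕ.+-suc (x n) (y n)) ⟨
    suc (x n) ℕ.+ suc (y n)   ≤⟨ ℕ.+-mono-≤ (x-suc n) (ℕ.<⇒≤ (y-gap n)) ⟩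
    x (suc n) ℕ.+ y (suc n)   ≡⟨ p≡x+y (suc n) ⟨
    p (suc n)                 ∎
    where open ℕ.≤-Reasoning

  x<y : ∀ n → x (suc n) ℕ.< y (suc n)
  x<y n = subst (x (suc n) ℕ.<_) (sym (y≡x+m (suc n)))
    (ℕ.m<m+n (x (suc n)) (ℕ.<-≤-trans (ℕ.s≤s ℕ.z≤n) (n≤m (suc n))))

  m<p : ∀ n → m (suc n) ℕ.< p (suc n)
  m<p n = begin-strict
    m (suc n)                              ≤⟨ ℕ.m≤n+m (m (suc n)) (x (suc n)) ⟩
    x (suc n) ℕ.+ m (suc n)                ≡⟨ y≡x+m (suc n) ⟨
    y (suc n)                              <⟨ ℕ.m<n+m (y (suc n)) (ℕ.<-≤-trans (ℕ.s≤s ℕ.z≤n) (n≤x (suc n))) ⟩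
    x (suc n) ℕ.+ y (suc n)                ≡⟨ p≡x+y (suc n) ⟨
    p (suc n)                              ∎
    where open ℕ.≤-Reasoning

  open Counting y-zero y-gap x<y using ()
    renaming (Splits to SplitsX; splits to splitsX)
  open GM.Counting p-zero p-gap m<p using ()
    renaming (Splits to SplitsM; splits to splitsM)

  -- From x a + m a ≤ n + a and a ≤ m a.
  SplitsX⇒x≤ : ∀ {n a} → SplitsX n a → x a ℕ.≤ n
  SplitsX⇒x≤ {n} {a} (x≡ , ya≤x , _) = ℕ.+-cancelʳ-≤ a (x a) n (begin
    x a ℕ.+ a     ≤⟨ ℕ.+-monoʳ-≤ (x a) (n≤m a) ⟩
    x a ℕ.+ m a   ≡⟨ y≡x+m a ⟨
    y a           ≤⟨ ya≤x ⟩
    x n           ≡⟨ x≡ ⟩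
    n ℕ.+ a       ∎)
    where open ℕ.≤-Reasoning

  -- From 2 x b + m b ≤ n + b.
  SplitsM⇒2b≤n : ∀ {n b} → SplitsM n b → b ℕ.+ b ℕ.≤ n
  SplitsM⇒2b≤n {n} {b} (m≡ , pb≤m , _) = ℕ.+-cancelʳ-≤ b (b ℕ.+ b) n (begin
    b ℕ.+ b ℕ.+ b           ≡⟨ ℕ.+-assoc b b b ⟩
    b ℕ.+ (b ℕ.+ b)         ≤⟨ ℕ.+-mono-≤ (n≤x b) (ℕ.+-mono-≤ (n≤x b) (n≤m b)) ⟩
    x b ℕ.+ (x b ℕ.+ m b)   ≡⟨ cong (x b ℕ.+_) (y≡x+m b) ⟨
    x b ℕ.+ y b             ≡⟨ p≡x+y b ⟨
    p b                     ≤⟨ pb≤m ⟩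
    m n                     ≡⟨ m≡ ⟩
    n ℕ.+ b                 ∎)
    where open ℕ.≤-Reasoning

  -- The difference x n - n counts values of y below x n, so it is at
  -- least k as soon as n ≥ y k.
  x-excess : ∀ k {n} → y k ℕ.≤ n → n ℕ.+ k ℕ.≤ x n
  x-excess k {n} yk≤n with splitsX n
  ... | a , x≡ , _ , x<y′ = subst (n ℕ.+ k ℕ.≤_) (sym x≡) (ℕ.+-monoʳ-≤ n k≤a)
    where
    k≤a : k ℕ.≤ a
    k≤a = ℕ.≤-pred (StrictlyIncreasing.reflect y (λ i → ℕ.<-trans (ℕ.n<1+n _) (y-gap i))
      (ℕ.≤-<-trans (ℕ.≤-trans yk≤n (n≤x n)) x<y′))

  -- If n is large, then n - a is large: either a stays below y k,
  -- or n ≥ x a ≥ a + k.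
  SplitsX⇒gap : ∀ k {n a} → SplitsX n a → y k ℕ.+ k ℕ.≤ n → a ℕ.+ k ℕ.≤ n
  SplitsX⇒gap k {n} {a} s n≥ with ℕ.≤-total (y k) a
  ... | inj₁ yk≤a = ℕ.≤-trans (x-excess k yk≤a) (SplitsX⇒x≤ s)
  ... | inj₂ a≤yk = ℕ.≤-trans (ℕ.+-monoˡ-≤ k a≤yk) n≥

  fromℕ-y : ∀ n → fromℕ (y n) ≡ fromℕ (x n) + fromℕ (m n)
  fromℕ-y n = trans (cong fromℕ (y≡x+m n)) (fromℕ-+ (x n) (m n))

  fromℕ-p : ∀ n → fromℕ (p n) ≡ fromℕ (x n) + (fromℕ (x n) + fromℕ (m n))
  fromℕ-p n = trans (cong fromℕ (p≡x+y n)) (trans (fromℕ-+ (x n) (y n)) (cong (λ z → fromℕ (x n) + z) (fromℕ-y n)))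

  module Approximation (r : ℚ) (3/2≤r : ℤ.+ 3 / 2 ≤ r) (r≤2 : r ≤ fromℕ 2) (d-1 : ℕ)
                       (0≤f : 0ℚ ≤ cubic r) (f-small : fromℕ 4 * cubic r ≤ ℤ.+ 1 / suc d-1)
    where

    open Reciprocal d-1

    -- Beyond N one has n - (a + 1) ≥ 2d and n ≥ 20d, that is,
    -- ε(n - (a + 1)) ≥ 2 ≥ r and εn ≥ 20.
    k N c : ℕ
    k = suc (2 ℕ.* d)
    N = (y k ℕ.+ k) ℕ.+ 20 ℕ.* d
    c = 8 ℕ.* N

    open Estimates r ε (fromℕ c) 3/2≤r r≤2 0≤ε (0≤fromℕ c)

    -- The error bounds at the index n, with constant part c.
    GoodAt : ℕ → Set
    GoodAt n = Good (fromℕ n) (fromℕ (x n)) (fromℕ (m n))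

    GoodAt-suc : ∀ {n} → GoodAt (suc n) → Good (fromℕ n + 1ℚ) (fromℕ (x (suc n))) (fromℕ (m (suc n)))
    GoodAt-suc {n} = subst (λ z → Good z (fromℕ (x (suc n))) (fromℕ (m (suc n)))) (fromℕ-suc n)

    module Step (n a b : ℕ) (sx : SplitsX n a) (sm : SplitsM n b) where

      x≡ : fromℕ (x n) ≡ fromℕ n + fromℕ a
      x≡ = trans (cong fromℕ (proj₁ sx)) (fromℕ-+ n a)

      m≡ : fromℕ (m n) ≡ fromℕ n + fromℕ b
      m≡ = trans (cong fromℕ (proj₁ sm)) (fromℕ-+ n b)

      a≤n : a ℕ.≤ n
      a≤n = ℕ.≤-trans (n≤x a) (SplitsX⇒x≤ sx)

      2b≤n : b ℕ.+ b ℕ.≤ n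
      2b≤n = SplitsM⇒2b≤n sm

      b≤n : b ℕ.≤ n
      b≤n = ℕ.≤-trans (ℕ.m≤m+n b b) 2b≤n

      good-initial : n ℕ.≤ N → GoodAt n
      good-initial n≤N = subst₂ (Good (fromℕ n)) (sym x≡) (sym m≡)
        (initial (fromℕ n) (fromℕ a) (fromℕ b) (fromℕ N)
          (0≤fromℕ a) (0≤fromℕ-diff a≤n) (0≤fromℕ b) (0≤fromℕ-diff b≤n) (0≤fromℕ n) (0≤fromℕ-diff n≤N)
          (fromℕ-* 8 N))

      below-y : 0ℚ ≤ (fromℕ n + fromℕ a) - (fromℕ (x a) + fromℕ (m a))
      below-y = subst₂ (λ s t → 0ℚ ≤ s - t) x≡ (fromℕ-y a) (0≤fromℕ-diff (proj₁ (proj₂ sx)))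

      above-y : 0ℚ ≤ (fromℕ (x (suc a)) + fromℕ (m (suc a))) - (fromℕ n + (fromℕ a + 1ℚ))
      above-y = subst₂ (λ s t → 0ℚ ≤ s - t) (fromℕ-y (suc a))
        (trans (fromℕ-+ n (suc a)) (cong (λ z → fromℕ n + z) (fromℕ-suc a)))
        (0≤fromℕ-diff (subst (ℕ._≤ y (suc a)) (trans (cong suc (proj₁ sx)) (sym (ℕ.+-suc n a))) (proj₂ (proj₂ sx))))

      below-p : 0ℚ ≤ (fromℕ n + fromℕ b) - (fromℕ (x b) + (fromℕ (x b) + fromℕ (m b)))
      below-p = subst₂ (λ s t → 0ℚ ≤ s - t) m≡ (fromℕ-p b) (0≤fromℕ-diff (proj₁ (proj₂ sm)))

      above-p : 0ℚ ≤ (fromℕ (x (suc b)) + (fromℕ (x (suc b)) + fromℕ (m (suc b)))) - (fromℕ n + (fromℕ b + 1ℚ))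
      above-p = subst₂ (λ s t → 0ℚ ≤ s - t) (fromℕ-p (suc b))
        (trans (fromℕ-+ n (suc b)) (cong (λ z → fromℕ n + z) (fromℕ-suc b)))
        (0≤fromℕ-diff (subst (ℕ._≤ p (suc b)) (trans (cong suc (proj₁ sm)) (sym (ℕ.+-suc n b))) (proj₂ (proj₂ sm))))

      good-step : N ℕ.≤ n → (∀ {i} → i ℕ.< n → GoodAt i) → GoodAt n
      good-step N≤n rec = subst₂ (Good (fromℕ n)) (sym x≡) (sym m≡) (record
        { U≤ = U-upper (fromℕ n) (fromℕ a) (rec a<n) below-y (0≤fromℕ-diff a≤n)
        ; U≥ = U-lower (fromℕ n) (fromℕ a) (GoodAt-suc (rec a′<n)) above-y a′-far
        ; V≤ = V-upper (fromℕ n) (fromℕ b) 0≤f (rec b<n) below-p (0≤fromℕ n) (0≤fromℕ-diff b≤n)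
        ; V≥ = V-lower (fromℕ n) (fromℕ b) 0≤f (p≤q⇒0≤q-p f-small) (p≤q⇒0≤q-p ε≤1)
                 (GoodAt-suc (rec b′<n)) above-p (0≤fromℕ n) (0≤fromℕ b)
                 (subst (λ z → 0ℚ ≤ fromℕ n - z) (fromℕ-+ b b) (0≤fromℕ-diff 2b≤n))
                 (p≤q⇒0≤q-p (≤ε* 20 (fromℕ-mono {20 ℕ.* d} {n} 20d≤n)))
        })
        where
        20d≤n : 20 ℕ.* d ℕ.≤ n
        20d≤n = ℕ.≤-trans (ℕ.m≤n+m (20 ℕ.* d) (y k ℕ.+ k)) N≤n

        a′+2d≤n : suc a ℕ.+ 2 ℕ.* d ℕ.≤ n
        a′+2d≤n = subst (ℕ._≤ n) (ℕ.+-suc a (2 ℕ.* d))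
          (SplitsX⇒gap k sx (ℕ.≤-trans (ℕ.m≤m+n (y k ℕ.+ k) (20 ℕ.* d)) N≤n))

        a′<n : suc a ℕ.< n
        a′<n = ℕ.<-≤-trans (ℕ.m<m+n (suc a) (ℕ.s≤s ℕ.z≤n)) a′+2d≤n

        a<n : a ℕ.< n
        a<n = ℕ.<-trans (ℕ.n<1+n a) a′<n

        3≤n : 3 ℕ.≤ n
        3≤n = ℕ.≤-trans (ℕ.≤-trans (ℕ.m≤m+n 3 17) (ℕ.m≤m*n 20 d)) 20d≤n

        b′<n : suc b ℕ.< n
        b′<n = ℕ.≰⇒> λ n≤b′ → ℕ.<⇒≱ 3≤n (ℕ.+-cancelˡ-≤ n n 2 (begin
          n ℕ.+ n             ≤⟨ ℕ.+-mono-≤ n≤b′ n≤b′ ⟩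
          suc b ℕ.+ suc b     ≡⟨ cong suc (ℕ.+-suc b b) ⟩
          2 ℕ.+ (b ℕ.+ b)     ≤⟨ ℕ.+-monoʳ-≤ 2 2b≤n ⟩
          2 ℕ.+ n             ≡⟨ ℕ.+-comm 2 n ⟩
          n ℕ.+ 2             ∎))
          where open ℕ.≤-Reasoning

        b<n : b ℕ.< n
        b<n = ℕ.<-trans (ℕ.n<1+n b) b′<n

        a′-far : 0ℚ ≤ ε * (fromℕ n - (fromℕ a + 1ℚ)) - r
        a′-far = p≤q⇒0≤q-p (≤-trans r≤2 (≤ε* 2
          (subst (λ z → fromℕ (2 ℕ.* d) ≤ fromℕ n - z) (fromℕ-suc a) 2d≤)))
          where
          add-sub : ∀ s t → s + t - s ≡ t
          add-sub = solve-∀ ℚ-ring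
          2d≤ : fromℕ (2 ℕ.* d) ≤ fromℕ n - fromℕ (suc a)
          2d≤ = subst (_≤ fromℕ n - fromℕ (suc a)) (add-sub (fromℕ (suc a)) (fromℕ (2 ℕ.* d)))
            (+-monoˡ-≤ (- fromℕ (suc a))
              (subst (_≤ fromℕ n) (fromℕ-+ (suc a) (2 ℕ.* d)) (fromℕ-mono a′+2d≤n)))

    good : ∀ n → GoodAt n
    good = <-rec GoodAt λ n rec → go n rec (splitsX n) (splitsM n) (ℕ.≤-total n N)
      where
      go : ∀ n → (∀ {i} → i ℕ.< n → GoodAt i) → ∃ (SplitsX n) → ∃ (SplitsM n) → n ℕ.≤ N ⊎ N ℕ.≤ n → GoodAt n
      go n rec (a , sx) (b , sm) (inj₁ n≤N) = Step.good-initial n a b sx sm n≤N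
      go n rec (a , sx) (b , sm) (inj₂ N≤n) = Step.good-step n a b sx sm N≤n rec

    -- For n ≥ 2cd the bound 2(εn + c) of ratio is at most 3εn, hence at most
    -- 3ε (x n).
    threshold : ℕ
    threshold = 2 ℕ.* c ℕ.* d

    y-r*x≤ : ∀ n → threshold ℕ.≤ n → ∣ fromℕ (y n) - r * fromℕ (x n) ∣ ≤ fromℕ 3 * ε * fromℕ (x n)
    y-r*x≤ n n≥ = ≤-trans
      (subst (λ z → ∣ z - r * fromℕ (x n) ∣ ≤ E (fromℕ n) + E (fromℕ n)) (sym (fromℕ-y n))
        (ratio {fromℕ n} {fromℕ (x n)} {fromℕ (m n)} (0≤fromℕ n) (good n)))
      (≤-from (id ε (fromℕ c) (fromℕ n) (fromℕ (x n)))
        (0≤fromℕ 3 ⊗ (0≤ε ⊗ 0≤fromℕ-diff (n≤x n)) ⊕ p≤q⇒0≤q-p (subst (_≤ ε * fromℕ n) (fromℕ-* 2 c)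
            (≤ε* (2 ℕ.* c) (fromℕ-mono n≥)))))
      where
      id : ∀ ε c n x → fromℕ 3 * ε * x - ((ε * n + c) + (ε * n + c)) ≡
           fromℕ 3 * (ε * (x - n)) + (ε * n - fromℕ 2 * c)
      id = solve-∀ ℚ-ring

    y/x-r≤ : ∀ n → threshold ℕ.≤ n → .{{_ : ℕ.NonZero (x n)}} → ∣ ℤ.+ y n / x n - r ∣ ≤ fromℕ 3 * ε
    y/x-r≤ n n≥ {{x≢0}} = *-cancelʳ-≤-pos (fromℕ (x n)) {{normalize-pos (x n) 1 {{_}} {{x≢0}}}} (begin
      ∣ q - r ∣ * X′          ≡⟨ cong (∣ q - r ∣ *_) (0≤p⇒∣p∣≡p (0≤fromℕ (x n))) ⟨
      ∣ q - r ∣ * ∣ X′ ∣      ≡⟨ ∣p*q∣≡∣p∣*∣q∣ (q - r) X′ ⟨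
      ∣ (q - r) * X′ ∣        ≡⟨ cong ∣_∣ (distrib q r X′) ⟩
      ∣ q * X′ - r * X′ ∣     ≡⟨ cong (λ z → ∣ z - r * X′ ∣) (/-*-cancel (y n) (x n)) ⟩
      ∣ fromℕ (y n) - r * X′ ∣  ≤⟨ y-r*x≤ n n≥ ⟩
      fromℕ 3 * ε * X′        ∎)
      where
      open ≤-Reasoning
      q = ℤ.+ y n / x n
      X′ = fromℕ (x n)
      distrib : ∀ q r x → (q - r) * x ≡ q * x - r * x
      distrib = solve-∀ ℚ-ring

  -- The distance from y/x to ψ is at most 3ε + 2ε, through r, and one more ε is
  -- the margin that the strict order of the reals asks for.
  y/x→ψ : (x-nonZero : ∀ n → ℕ.NonZero (x (suc n))) (ψ : ℝ) → IsTribonacciRoot ψ →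
    Limit (λ n → fromℚ ((ℤ.+ y (suc n) / x (suc n)) {{x-nonZero n}})) ψ
  y/x→ψ x-nonZero ψ isRoot η (δ , 0<δ , A , 0+δ<η) with archimedean δ 0<δ
  ... | i , 1≤ = threshold , λ n n≥ → ε , 0<ε , A ℕ.⊔ UA.start , λ k k≥ →
      ≤-<-trans (bound n n≥ k (ℕ.m⊔n≤o⇒n≤o A UA.start k≥)) (0+δ<η k (ℕ.m⊔n≤o⇒m≤o A UA.start k≥))
    where
    -- This makes d equal to 6 * suc i, hence 6ε ≤ δ.
    d-1 = i ℕ.+ 5 ℕ.* suc i
    module UA = UpperApprox (upperApprox ψ isRoot d-1)
    open Reciprocal d-1
    open Approximation UA.r UA.3/2≤r UA.r≤2 d-1 UA.0≤f UA.f-small using (threshold; y/x-r≤)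

    6ε≤δ : fromℕ 6 * ε ≤ δ
    6ε≤δ = begin
      fromℕ 6 * ε                               ≡⟨ *-identityʳ (fromℕ 6 * ε) ⟨
      fromℕ 6 * ε * 1ℚ                          ≤⟨ ≤-from (id ε (fromℕ (suc i)) δ)
                                                     (0≤fromℕ 6 ⊗ 0≤ε ⊗ p≤q⇒0≤q-p 1≤) ⟩
      ε * (fromℕ 6 * fromℕ (suc i)) * δ         ≡⟨ cong (λ z → ε * z * δ) (fromℕ-* 6 (suc i)) ⟨
      ε * fromℕ d * δ                           ≡⟨ cong (_* δ) ε*d≡1 ⟩
      1ℚ * δ                                    ≡⟨ *-identityˡ δ ⟩
      δ                                         ∎
      where
      open ≤-Reasoning
      id : ∀ e i δ → e * (fromℕ 6 * i) * δ - fromℕ 6 * e * 1ℚ ≡ fromℕ 6 * e * (i * δ - 1ℚ)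
      id = solve-∀ ℚ-ring

    bound : ∀ n → threshold ℕ.≤ n → ∀ k → UA.start ℕ.≤ k →
            ∣ (ℤ.+ y (suc n) / x (suc n)) {{x-nonZero n}} - seq ψ k ∣ + ε ≤ 0ℚ + δ
    bound n n≥ k k≥ = begin
      ∣ q - seq ψ k ∣ + ε
        ≡⟨ cong (λ z → ∣ z ∣ + ε) (insert q UA.r (seq ψ k)) ⟩
      ∣ (q - UA.r) + (UA.r - seq ψ k) ∣ + ε
        ≤⟨ +-monoˡ-≤ ε (≤-trans (∣p+q∣≤∣p∣+∣q∣ (q - UA.r) (UA.r - seq ψ k))
             (+-mono-≤ (y/x-r≤ (suc n) (ℕ.m≤n⇒m≤1+n n≥) {{x-nonZero n}}) (UA.near k k≥))) ⟩
      fromℕ 3 * ε + fromℕ 2 * ε + ε       ≡⟨ total ε ⟩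
      fromℕ 6 * ε                         ≤⟨ 6ε≤δ ⟩
      δ                                   ≡⟨ +-identityˡ δ ⟨
      0ℚ + δ                              ∎
      where
      open ≤-Reasoning
      q = (ℤ.+ y (suc n) / x (suc n)) {{x-nonZero n}}
      insert : ∀ q r p → q - p ≡ (q - r) + (r - p)
      insert = solve-∀ ℚ-ring
      total : ∀ e → fromℕ 3 * e + fromℕ 2 * e + e ≡ fromℕ 6 * e
      total = solve-∀ ℚ-ring

------------------------------------------------------------------------
-- The four sequences

Y≡X+M : ∀ n → Y n ≡ X n ℕ.+ M n
Y≡X+M zero    = refl
Y≡X+M (suc n) = refl

P≡X+Y : ∀ n → P n ≡ X n ℕ.+ Y n
P≡X+Y zero    = refl
P≡X+Y (suc n) = refl

mainTheorem5 : (ψ : ℝ) → ψ *ᵣ ψ *ᵣ ψ ≃ᵣ ψ *ᵣ ψ +ᵣ ψ +ᵣ 1ᵣ →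
    Limit (λ n → fromℚ ((+ Y (suc n) / X (suc n)) {{X-nonZero n}})) ψ
mainTheorem5 = y/x→ψ X-nonZero
  where
  open MexQuadruple X Y M P XY MP refl (λ _ → refl) refl (λ _ → refl) refl (λ n → mex-isMex (XY (suc n)))
    refl (λ n → mex-isMex (MP (suc n))) Y≡X+M P≡X+Y using (y/x→ψ)
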